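{- Let $S \subseteq \mathbb{N}$ be a $\Sigma_1^0$ set, and let $p_0,p_1,p_2,\dots$ list the usual primes of $\mathbb{N}$ in increasing order. There exists a strongly computable finite factorization domain $A$ such that: $\mathbb{Z}$ is a subring of $A$; $U(A) = \{1,-1\}$; every $p_i$ is irreducible in $A$; and $p_i$ is prime in $A$ if and only if $i \notin S$.
   Context: A set $Z \subseteq \mathbb{N}$ is $\Sigma_1^0$ (computably enumerable) if there is a computable $R \subseteq \mathbb{N}^2$ with $i \in Z \iff \exists x\, R(x,i)$. A computable ring is a ring whose underlying set is a computable set $A \subseteq \mathbb{N}$ with addition and multiplication computable functions $A\times A \to A$. A strongly computable finite factorization domain (SCFFD) is a computable integral domain $A$ equipped with a computable function $D$ such that for every nonzero $a \in A$, $D(a)$ is a canonical index for the finite set of all divisors of $a$ in $A$. $U(A)$ denotes the group of units of $A$. -}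

module Defs where

open import Data.Nat as ℕ using (ℕ)
open import Data.Nat.Primality using (prime?)
open import Data.Integer as ℤ using (ℤ)
open import Data.Bool using (Bool; true; T)
open import Data.List using (List; length; filter; upTo)
open import Data.List.Membership.Propositional using (_∈_)
open import Data.Product using (Σ; ∃; _×_; _,_)
open import Data.Sum using (_⊎_)
open import Relation.Nullary using (¬_)
open import Data.Nat.Primality using (Prime)
open import Relation.Binary.PropositionalEquality using (_≡_)
open import Function.Bundles using (_⇔_)
open import Function.Definitions using (Injective)
open import Algebra.Structures using (IsCommutativeRing)

-- A Σ⁰₁ set given by a computable relation R (an Agda function, hence computable):
-- i ∈ Z  iff  ∃ x. R(x,i)
Σ₁Set : (ℕ → ℕ → Bool) → ℕ → Set
Σ₁Set R i = ∃ λ x → R x i ≡ true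

Elt : (ℕ → Bool) → Set
Elt dom = Σ ℕ (λ n → T (dom n))

-- Strongly computable finite factorization domain:
-- a computable integral domain (carrier a computable subset of ℕ, computable
-- operations) with a computable function D listing all divisors of each nonzero a.
record SCFFD : Set₁ where
  infixl 7 _*_
  infixl 6 _+_
  field
    dom : ℕ → Bool
    _+_ _*_ : Elt dom → Elt dom → Elt dom
    -_ : Elt dom → Elt dom
    0# 1# : Elt dom
    isCommutativeRing : IsCommutativeRing _≡_ _+_ _*_ -_ 0# 1#
    1≢0 : ¬ (1# ≡ 0#)
    noZeroDivisors : ∀ a b → a * b ≡ 0# → a ≡ 0# ⊎ b ≡ 0#
    D : Elt dom → List (Elt dom)
    D-spec : ∀ a → ¬ (a ≡ 0#) → ∀ b → (b ∈ D a) ⇔ (∃ λ c → b * c ≡ a)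

module DomainNotions (𝒜 : SCFFD) where
  open SCFFD 𝒜

  _∣_ : Elt dom → Elt dom → Set
  b ∣ a = ∃ λ c → b * c ≡ a

  IsUnit : Elt dom → Set
  IsUnit u = ∃ λ v → u * v ≡ 1#

  IsIrreducible : Elt dom → Set
  IsIrreducible p = ¬ (p ≡ 0#) × ¬ IsUnit p
                  × (∀ a b → a * b ≡ p → IsUnit a ⊎ IsUnit b)

  IsPrime : Elt dom → Set
  IsPrime p = ¬ (p ≡ 0#) × ¬ IsUnit p
            × (∀ a b → p ∣ (a * b) → p ∣ a ⊎ p ∣ b)

  IsRingHomFromℤ : (ℤ → Elt dom) → Set
  IsRingHomFromℤ ι = (∀ x y → ι (x ℤ.+ y) ≡ ι x + ι y)
                   × (∀ x y → ι (x ℤ.* y) ≡ ι x * ι y)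
                   × (ι (ℤ.+ 1) ≡ 1#)

  ℤSubring : (ℤ → Elt dom) → Set
  ℤSubring ι = IsRingHomFromℤ ι × Injective _≡_ _≡_ ι

-- number of (usual) primes strictly below p; p is the i-th prime p_i
-- (0-indexed, p_0 = 2) iff p is prime and primesBelow p ≡ i
primesBelow : ℕ → ℕ
primesBelow p = length (filter prime? (upTo p))

module _ (R : ℕ → ℕ → Bool) (𝒜 : SCFFD) where
  open SCFFD 𝒜
  open DomainNotions 𝒜

  Theorem11Properties : Set
  Theorem11Properties =
    Σ (ℤ → Elt dom) λ ι →
      ℤSubring ι
      × (∀ u → IsUnit u ⇔ (u ≡ ι (ℤ.+ 1) ⊎ u ≡ ι (ℤ.- (ℤ.+ 1))))
      × (∀ i p → Prime p → primesBelow p ≡ i →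
           IsIrreducible (ι (ℤ.+ p)) × (IsPrime (ι (ℤ.+ p)) ⇔ (¬ Σ₁Set R i)))

module Submission where

-- A is a subring of the semigroup ring ℤ[ℕ⁺] of the multiplicative monoid of
-- positive integers (basis X_n, X_m X_n = X_{mn}).  A prime p is "active" at a
-- prime key q when p ≤ q and some s ≤ q witnesses primesBelow p ∈ S; A is the set
-- of elements whose coefficient at every prime key q is divisible by every prime
-- active at q.
-- If i ∉ S, p_i is active nowhere and is prime by Gauss' lemma; if i ∈ S, an
-- element u = p·N·X_q (q a large prime) has p ∣ u² but p ∤ u in A.

open import Defs
open import Data.Empty using (⊥; ⊥-elim)
open import Data.Bool using (Bool; true; T) renaming (_≟_ to _≟ᵇ_)
open import Data.Bool.Properties using (T-irrelevant)
open import Data.Nat as N using (ℕ; zero; suc; _≤_; _<_; z≤n; s≤s; _^_; _!)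
import Data.Nat.Properties as NP
import Data.Nat.Divisibility as ND
open import Data.Nat.Primality using (Prime; prime?; euclidsLemma; prime⇒irreducible; prime⇒nonZero; ¬prime[1])
open import Data.Nat.Primality.Factorisation using (factorise; PrimeFactorisation; factorisationHasAllPrimeFactors)
open import Data.Nat.ListAction using (product)
open import Data.Nat.ListAction.Properties using (∈⇒∣product; product≢0)
open import Data.Integer as Z using (ℤ; +_; -[1+_]; 0ℤ; 1ℤ)
import Data.Integer.Properties as ZP
import Data.Integer.Divisibility.Signed as DS
open import Data.List using (List; []; _∷_; map; concatMap; _++_; length; filter; upTo)
import Data.List.Properties as LP
open import Data.List.Relation.Unary.All as All using (All; []; _∷_)
open import Data.List.Relation.Unary.Any using (Any; any?; here; there)
open import Data.List.Membership.Propositional using (_∈_; lose; find)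
open import Data.List.Membership.Propositional.Properties using (∈-filter⁺; ∈-filter⁻; ∈-upTo⁺; ∈-map⁺; ∈-map⁻; ∈-++⁺ˡ; ∈-++⁺ʳ)
open import Data.Product using (Σ; ∃; _×_; _,_; proj₁; proj₂)
open import Data.Sum using (_⊎_; inj₁; inj₂; [_,_]′) renaming (map to map⊎)
open import Relation.Binary.PropositionalEquality
open import Relation.Binary.Definitions using (tri<; tri≈; tri>)
open import Relation.Nullary using (¬_; yes; no; Dec; ¬?)
open import Relation.Nullary.Decidable using (_×-dec_; _→-dec_; isYes; toWitness; fromWitness)
open import Function.Bundles using (_⇔_; mk⇔)
open import Algebra.Structures using (IsCommutativeRing)
open import Data.Integer.Tactic.RingSolver using (solve-∀)
open import Data.Nat.Tactic.RingSolver using () renaming (solve-∀ to solve-∀ℕ)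

-- An element is a coefficient list; position i holds the coefficient of the
-- basis element X_{i+1}, so that X_{m} X_{n} = X_{mn} becomes i ⊛ j below.
-- Canonical representatives are the lists without trailing zeros ("normal");
-- every ring law is proved by testing against all functionals Ψ G.
module SemigroupRing where

  Poly : Set
  Poly = List ℤ

  at : Poly → ℕ → ℤ
  at [] _ = 0ℤ
  at (x ∷ xs) zero = x
  at (x ∷ xs) (suc i) = at xs i

  cons' : ℤ → Poly → Poly
  cons' x [] with x Z.≟ 0ℤ
  ... | yes _ = []
  ... | no _ = x ∷ []
  cons' x (y ∷ ys) = x ∷ y ∷ ys

  norm : Poly → Poly
  norm [] = []
  norm (x ∷ xs) = cons' x (norm xs)

  Normal : Poly → Set
  Normal xs = norm xs ≡ xs

  at-cons' : ∀ x ys i → at (cons' x ys) i ≡ at (x ∷ ys) i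
  at-cons' x [] i with x Z.≟ 0ℤ
  at-cons' x [] zero | yes x≡0 = sym x≡0
  at-cons' x [] (suc i) | yes _ = refl
  ... | no _ = refl
  at-cons' x (y ∷ ys) i = refl

  at-norm : ∀ xs i → at (norm xs) i ≡ at xs i
  at-norm [] i = refl
  at-norm (x ∷ xs) zero = at-cons' x (norm xs) zero
  at-norm (x ∷ xs) (suc i) = trans (at-cons' x (norm xs) (suc i)) (at-norm xs i)

  cons'-nonzero : ∀ x ys → ¬ x ≡ 0ℤ → cons' x ys ≡ x ∷ ys
  cons'-nonzero x [] x≢0 with x Z.≟ 0ℤ
  ... | yes x≡0 = ⊥-elim (x≢0 x≡0)
  ... | no _ = refl
  cons'-nonzero x (y ∷ ys) _ = refl

  cons'-tail : ∀ x ys zs → cons' x ys ≡ x ∷ zs → ys ≡ zs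
  cons'-tail x [] zs e with x Z.≟ 0ℤ | e
  ... | yes _ | ()
  ... | no _ | refl = refl
  cons'-tail x (y ∷ ys) zs refl = refl

  normal-tail : ∀ x xs → Normal (x ∷ xs) → Normal xs
  normal-tail x xs = cons'-tail x (norm xs) xs

  norm-idem : ∀ xs → Normal (norm xs)
  norm-idem [] = refl
  norm-idem (x ∷ xs) = cons'-normal x (norm xs) (norm-idem xs)
    where
    cons'-normal : ∀ x ys → Normal ys → Normal (cons' x ys)
    cons'-normal x [] _ with x Z.≟ 0ℤ
    ... | yes _ = refl
    ... | no x≢0 = cons'-nonzero x [] x≢0
    cons'-normal x (y ∷ ys) n = cong (cons' x) n

  norm-zero : ∀ xs → (∀ i → at xs i ≡ 0ℤ) → norm xs ≡ []
  norm-zero [] h = refl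
  norm-zero (x ∷ xs) h rewrite norm-zero xs (λ i → h (suc i)) with x Z.≟ 0ℤ
  ... | yes _ = refl
  ... | no x≢0 = ⊥-elim (x≢0 (h zero))

  ext : ∀ xs ys → Normal xs → Normal ys → (∀ i → at xs i ≡ at ys i) → xs ≡ ys
  ext [] [] nx ny h = refl
  ext [] (y ∷ ys) nx ny h = trans (sym (norm-zero (y ∷ ys) (λ i → sym (h i)))) ny
  ext (x ∷ xs) [] nx ny h = trans (sym nx) (norm-zero (x ∷ xs) h)
  ext (x ∷ xs) (y ∷ ys) nx ny h =
    cong₂ _∷_ (h zero) (ext xs ys (normal-tail x xs nx) (normal-tail y ys ny) (λ i → h (suc i)))

  -- Terms (k , a) stand for a·X_{k+1}; an element is a sum of terms.
  Term : Set
  Term = ℕ × ℤ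

  termsFrom : ℕ → Poly → List Term
  termsFrom k [] = []
  termsFrom k (x ∷ xs) = (k , x) ∷ termsFrom (suc k) xs

  terms : Poly → List Term
  terms = termsFrom 0

  -- The linear functional sending X_{k+1} to G k.  Every computation below
  -- (ring laws, evaluations, coefficient extraction) is an instance of Φ.
  Φ : (ℕ → ℤ) → List Term → ℤ
  Φ G [] = 0ℤ
  Φ G ((k , a) ∷ ts) = a Z.* G k Z.+ Φ G ts

  Ψ : (ℕ → ℤ) → Poly → ℤ
  Ψ G xs = Φ G (terms xs)

  Φ-cong : ∀ {G H} ts → (∀ k → G k ≡ H k) → Φ G ts ≡ Φ H ts
  Φ-cong [] h = refl
  Φ-cong ((k , a) ∷ ts) h = cong₂ Z._+_ (cong (a Z.*_) (h k)) (Φ-cong ts h)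

  Φ-++ : ∀ G ts us → Φ G (ts ++ us) ≡ Φ G ts Z.+ Φ G us
  Φ-++ G [] us = sym (ZP.+-identityˡ _)
  Φ-++ G ((k , a) ∷ ts) us rewrite Φ-++ G ts us = sym (ZP.+-assoc (a Z.* G k) _ _)

  Φ-0 : ∀ ts → Φ (λ _ → 0ℤ) ts ≡ 0ℤ
  Φ-0 [] = refl
  Φ-0 ((k , a) ∷ ts) rewrite Φ-0 ts | ZP.*-zeroʳ a = refl

  Φ-+ : ∀ G H ts → Φ (λ k → G k Z.+ H k) ts ≡ Φ G ts Z.+ Φ H ts
  Φ-+ G H [] = refl
  Φ-+ G H ((k , a) ∷ ts) rewrite Φ-+ G H ts = lem a (G k) (H k) (Φ G ts) (Φ H ts)
    where lem : ∀ a g h x y → a Z.* (g Z.+ h) Z.+ (x Z.+ y) ≡ a Z.* g Z.+ x Z.+ (a Z.* h Z.+ y)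
          lem = solve-∀

  Φ-* : ∀ c G ts → Φ (λ k → c Z.* G k) ts ≡ c Z.* Φ G ts
  Φ-* c G [] = sym (ZP.*-zeroʳ c)
  Φ-* c G ((k , a) ∷ ts) rewrite Φ-* c G ts = lem a c (G k) (Φ G ts)
    where lem : ∀ a c g x → a Z.* (c Z.* g) Z.+ c Z.* x ≡ c Z.* (a Z.* g Z.+ x)
          lem = solve-∀

  Φ-swap : ∀ (F : ℕ → ℕ → ℤ) ts us →
    Φ (λ k → Φ (λ l → F k l) us) ts ≡ Φ (λ l → Φ (λ k → F k l) ts) us
  Φ-swap F [] us = sym (Φ-0 us)
  Φ-swap F ((k , a) ∷ ts) us = begin
      a Z.* Φ (F k) us Z.+ Φ (λ k → Φ (λ l → F k l) us) ts
    ≡⟨ cong₂ Z._+_ (sym (Φ-* a (F k) us)) (Φ-swap F ts us) ⟩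
      Φ (λ l → a Z.* F k l) us Z.+ Φ (λ l → Φ (λ k → F k l) ts) us
    ≡⟨ sym (Φ-+ _ _ us) ⟩
      Φ (λ l → a Z.* F k l Z.+ Φ (λ k → F k l) ts) us ∎
    where open ≡-Reasoning

  -- multiplication of keys: (i+1)(j+1) = (i ⊛ j) + 1
  infixl 7 _⊛_
  _⊛_ : ℕ → ℕ → ℕ
  i ⊛ j = i N.+ j N.+ i N.* j

  ⊛-suc : ∀ a b → suc (a ⊛ b) ≡ suc a N.* suc b
  ⊛-suc = lem
    where lem : ∀ a b → suc (a N.+ b N.+ a N.* b) ≡ suc a N.* suc b
          lem = solve-∀ℕ

  ⊛-assoc : ∀ a b c → (a ⊛ b) ⊛ c ≡ a ⊛ (b ⊛ c)
  ⊛-assoc = lem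
    where lem : ∀ a b c → (a N.+ b N.+ a N.* b) N.+ c N.+ (a N.+ b N.+ a N.* b) N.* c
                          ≡ a N.+ (b N.+ c N.+ b N.* c) N.+ a N.* (b N.+ c N.+ b N.* c)
          lem = solve-∀ℕ

  ⊛-comm : ∀ a b → a ⊛ b ≡ b ⊛ a
  ⊛-comm = lem
    where lem : ∀ a b → a N.+ b N.+ a N.* b ≡ b N.+ a N.+ b N.* a
          lem = solve-∀ℕ

  _⊗_ : Term → Term → Term
  (k , a) ⊗ (l , b) = (k ⊛ l , a Z.* b)

  prod : List Term → List Term → List Term
  prod ts us = concatMap (λ t → map (t ⊗_) us) ts

  Φ-map⊗ : ∀ G k a us → Φ G (map ((k , a) ⊗_) us) ≡ a Z.* Φ (λ l → G (k ⊛ l)) us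
  Φ-map⊗ G k a [] = sym (ZP.*-zeroʳ a)
  Φ-map⊗ G k a ((l , b) ∷ us) rewrite Φ-map⊗ G k a us = lem a b (G (k ⊛ l)) (Φ (λ l → G (k ⊛ l)) us)
    where lem : ∀ a b g x → a Z.* b Z.* g Z.+ a Z.* x ≡ a Z.* (b Z.* g Z.+ x)
          lem = solve-∀

  Φ-prod : ∀ G ts us → Φ G (prod ts us) ≡ Φ (λ k → Φ (λ l → G (k ⊛ l)) us) ts
  Φ-prod G [] us = refl
  Φ-prod G ((k , a) ∷ ts) us =
    trans (Φ-++ G (map ((k , a) ⊗_) us) (prod ts us))
          (cong₂ Z._+_ (Φ-map⊗ G k a us) (Φ-prod G ts us))

  addRaw : Poly → Poly → Poly
  addRaw [] ys = ys
  addRaw (x ∷ xs) [] = x ∷ xs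
  addRaw (x ∷ xs) (y ∷ ys) = x Z.+ y ∷ addRaw xs ys

  at-addRaw : ∀ xs ys i → at (addRaw xs ys) i ≡ at xs i Z.+ at ys i
  at-addRaw [] ys i = sym (ZP.+-identityˡ _)
  at-addRaw (x ∷ xs) [] i = sym (ZP.+-identityʳ _)
  at-addRaw (x ∷ xs) (y ∷ ys) zero = refl
  at-addRaw (x ∷ xs) (y ∷ ys) (suc i) = at-addRaw xs ys i

  Φ-addRaw : ∀ G k xs ys → Φ G (termsFrom k (addRaw xs ys)) ≡ Φ G (termsFrom k xs) Z.+ Φ G (termsFrom k ys)
  Φ-addRaw G k [] ys = sym (ZP.+-identityˡ _)
  Φ-addRaw G k (x ∷ xs) [] = sym (ZP.+-identityʳ _)
  Φ-addRaw G k (x ∷ xs) (y ∷ ys) rewrite Φ-addRaw G (suc k) xs ys =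
    lem x y (G k) (Φ G (termsFrom (suc k) xs)) (Φ G (termsFrom (suc k) ys))
    where lem : ∀ x y g a b → (x Z.+ y) Z.* g Z.+ (a Z.+ b) ≡ x Z.* g Z.+ a Z.+ (y Z.* g Z.+ b)
          lem = solve-∀

  Φ-zeros : ∀ G k xs → (∀ i → at xs i ≡ 0ℤ) → Φ G (termsFrom k xs) ≡ 0ℤ
  Φ-zeros G k [] h = refl
  Φ-zeros G k (x ∷ xs) h rewrite h zero | Φ-zeros G (suc k) xs (λ i → h (suc i)) = refl

  Φ-at : ∀ G k xs ys → (∀ i → at xs i ≡ at ys i) → Φ G (termsFrom k xs) ≡ Φ G (termsFrom k ys)
  Φ-at G k [] ys h = sym (Φ-zeros G k ys (λ i → sym (h i)))
  Φ-at G k (x ∷ xs) [] h = Φ-zeros G k (x ∷ xs) h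
  Φ-at G k (x ∷ xs) (y ∷ ys) h = cong₂ Z._+_ (cong (Z._* G k) (h zero)) (Φ-at G (suc k) xs ys (λ i → h (suc i)))

  Ψ-at : ∀ G xs ys → (∀ i → at xs i ≡ at ys i) → Ψ G xs ≡ Ψ G ys
  Ψ-at G = Φ-at G 0

  Ψ-norm : ∀ G xs → Ψ G (norm xs) ≡ Ψ G xs
  Ψ-norm G xs = Ψ-at G (norm xs) xs (at-norm xs)

  δ : ℕ → ℕ → ℤ
  δ j l with j N.≟ l
  ... | yes _ = 1ℤ
  ... | no _ = 0ℤ

  δ-refl : ∀ j → δ j j ≡ 1ℤ
  δ-refl j with j N.≟ j
  ... | yes _ = refl
  ... | no j≢j = ⊥-elim (j≢j refl)

  δ-≢ : ∀ j l → ¬ j ≡ l → δ j l ≡ 0ℤ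
  δ-≢ j l j≢l with j N.≟ l
  ... | yes j≡l = ⊥-elim (j≢l j≡l)
  ... | no _ = refl

  Φ-δ-below : ∀ j k xs → j < k → Φ (δ j) (termsFrom k xs) ≡ 0ℤ
  Φ-δ-below j k [] lt = refl
  Φ-δ-below j k (x ∷ xs) lt rewrite δ-≢ j k (λ e → NP.<-irrefl e lt)
    | Φ-δ-below j (suc k) xs (NP.m<n⇒m<1+n lt) | ZP.*-zeroʳ x = refl

  at-Φ : ∀ k xs i → at xs i ≡ Φ (δ (k N.+ i)) (termsFrom k xs)
  at-Φ k [] i = refl
  at-Φ k (x ∷ xs) zero rewrite NP.+-identityʳ k | δ-refl k
    | Φ-δ-below k (suc k) xs (NP.n<1+n k) | ZP.*-identityʳ x = sym (ZP.+-identityʳ x)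
  at-Φ k (x ∷ xs) (suc i) rewrite δ-≢ (k N.+ suc i) k (λ e → NP.m+1+n≢m k e)
    | ZP.*-zeroʳ x | NP.+-suc k i = trans (at-Φ (suc k) xs i) (sym (ZP.+-identityˡ _))

  at-Ψ : ∀ xs i → at xs i ≡ Ψ (δ i) xs
  at-Ψ xs i = at-Φ 0 xs i

  extΨ : ∀ xs ys → Normal xs → Normal ys → (∀ G → Ψ G xs ≡ Ψ G ys) → xs ≡ ys
  extΨ xs ys nx ny h = ext xs ys nx ny (λ i → trans (at-Ψ xs i) (trans (h (δ i)) (sym (at-Ψ ys i))))

  -- the monomial a·X_{i+1}
  pad : ℕ → ℤ → Poly
  pad zero a = a ∷ []
  pad (suc i) a = 0ℤ ∷ pad i a

  Φ-pad : ∀ G k i a → Φ G (termsFrom k (pad i a)) ≡ a Z.* G (k N.+ i)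
  Φ-pad G k zero a rewrite NP.+-identityʳ k = ZP.+-identityʳ _
  Φ-pad G k (suc i) a rewrite Φ-pad G (suc k) i a | NP.+-suc k i = ZP.+-identityˡ _

  Ψ-pad : ∀ G i a → Ψ G (pad i a) ≡ a Z.* G i
  Ψ-pad G i a = Φ-pad G 0 i a

  at-pad-same : ∀ i a → at (pad i a) i ≡ a
  at-pad-same zero a = refl
  at-pad-same (suc i) a = at-pad-same i a

  at-pad-other : ∀ i a j → ¬ j ≡ i → at (pad i a) j ≡ 0ℤ
  at-pad-other zero a zero ne = ⊥-elim (ne refl)
  at-pad-other zero a (suc j) ne = refl
  at-pad-other (suc i) a zero ne = refl
  at-pad-other (suc i) a (suc j) ne = at-pad-other i a j (λ e → ne (cong suc e))

  normal-pad : ∀ i a → ¬ a ≡ 0ℤ → Normal (pad i a)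
  normal-pad zero a a≢0 = cons'-nonzero a [] a≢0
  normal-pad (suc i) a a≢0 = trans (cong (cons' 0ℤ) (normal-pad i a a≢0)) (cons'-pad i)
    where cons'-pad : ∀ i → cons' 0ℤ (pad i a) ≡ 0ℤ ∷ pad i a
          cons'-pad zero = refl
          cons'-pad (suc i) = refl

  fromTerms : List Term → Poly
  fromTerms [] = []
  fromTerms ((k , a) ∷ ts) = addRaw (pad k a) (fromTerms ts)

  Ψ-fromTerms : ∀ G ts → Ψ G (fromTerms ts) ≡ Φ G ts
  Ψ-fromTerms G [] = refl
  Ψ-fromTerms G ((k , a) ∷ ts) rewrite Φ-addRaw G 0 (pad k a) (fromTerms ts)
    | Φ-pad G 0 k a | Ψ-fromTerms G ts = refl

  padd : Poly → Poly → Poly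
  padd xs ys = norm (addRaw xs ys)

  pneg : Poly → Poly
  pneg xs = norm (map Z.-_ xs)

  pmul : Poly → Poly → Poly
  pmul xs ys = norm (fromTerms (prod (terms xs) (terms ys)))

  p0 : Poly
  p0 = []

  -- the constant z = z·X_1
  pconst : ℤ → Poly
  pconst z = norm (z ∷ [])

  p1 : Poly
  p1 = pconst 1ℤ

  n-padd : ∀ xs ys → Normal (padd xs ys)
  n-padd xs ys = norm-idem (addRaw xs ys)

  n-pneg : ∀ xs → Normal (pneg xs)
  n-pneg xs = norm-idem (map Z.-_ xs)

  n-pmul : ∀ xs ys → Normal (pmul xs ys)
  n-pmul xs ys = norm-idem (fromTerms (prod (terms xs) (terms ys)))

  n-pconst : ∀ z → Normal (pconst z)
  n-pconst z = norm-idem (z ∷ [])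

  Ψ-padd : ∀ G xs ys → Ψ G (padd xs ys) ≡ Ψ G xs Z.+ Ψ G ys
  Ψ-padd G xs ys = trans (Ψ-norm G (addRaw xs ys)) (Φ-addRaw G 0 xs ys)

  Φ-neg : ∀ G k xs → Φ G (termsFrom k (map Z.-_ xs)) ≡ Z.- Φ G (termsFrom k xs)
  Φ-neg G k [] = refl
  Φ-neg G k (x ∷ xs) rewrite Φ-neg G (suc k) xs = lem x (G k) (Φ G (termsFrom (suc k) xs))
    where lem : ∀ x g a → Z.- x Z.* g Z.+ Z.- a ≡ Z.- (x Z.* g Z.+ a)
          lem = solve-∀

  Ψ-pneg : ∀ G xs → Ψ G (pneg xs) ≡ Z.- Ψ G xs
  Ψ-pneg G xs = trans (Ψ-norm G (map Z.-_ xs)) (Φ-neg G 0 xs)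

  Ψ-pmul : ∀ G xs ys → Ψ G (pmul xs ys) ≡ Φ (λ k → Ψ (λ l → G (k ⊛ l)) ys) (terms xs)
  Ψ-pmul G xs ys = begin
      Ψ G (norm (fromTerms (prod (terms xs) (terms ys))))
    ≡⟨ Ψ-norm G (fromTerms (prod (terms xs) (terms ys))) ⟩
      Ψ G (fromTerms (prod (terms xs) (terms ys)))
    ≡⟨ Ψ-fromTerms G (prod (terms xs) (terms ys)) ⟩
      Φ G (prod (terms xs) (terms ys))
    ≡⟨ Φ-prod G (terms xs) (terms ys) ⟩
      Φ (λ k → Ψ (λ l → G (k ⊛ l)) ys) (terms xs) ∎
    where open ≡-Reasoning

  at-padd : ∀ x y i → at (padd x y) i ≡ at x i Z.+ at y i
  at-padd x y i = trans (at-norm (addRaw x y) i) (at-addRaw x y i)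

  at-negRaw : ∀ xs i → at (map Z.-_ xs) i ≡ Z.- at xs i
  at-negRaw [] i = refl
  at-negRaw (x ∷ xs) zero = refl
  at-negRaw (x ∷ xs) (suc i) = at-negRaw xs i

  at-pneg : ∀ x i → at (pneg x) i ≡ Z.- at x i
  at-pneg x i = trans (at-norm (map Z.-_ x) i) (at-negRaw x i)

  Ψ-pconst : ∀ G z → Ψ G (pconst z) ≡ z Z.* G 0
  Ψ-pconst G z = trans (Ψ-norm G (z ∷ [])) (ZP.+-identityʳ _)

  +-assocP : ∀ x y z → padd (padd x y) z ≡ padd x (padd y z)
  +-assocP x y z = extΨ (padd (padd x y) z) (padd x (padd y z)) (n-padd (padd x y) z) (n-padd x (padd y z)) λ G →
    trans (Ψ-padd G (padd x y) z) (trans (cong (Z._+ Ψ G z) (Ψ-padd G x y))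
    (trans (ZP.+-assoc (Ψ G x) (Ψ G y) (Ψ G z))
    (sym (trans (Ψ-padd G x (padd y z)) (cong (λ w → Ψ G x Z.+ w) (Ψ-padd G y z))))))

  +-commP : ∀ x y → padd x y ≡ padd y x
  +-commP x y = extΨ (padd x y) (padd y x) (n-padd x y) (n-padd y x) λ G →
    trans (Ψ-padd G x y) (trans (ZP.+-comm (Ψ G x) (Ψ G y)) (sym (Ψ-padd G y x)))

  +-idˡP : ∀ x → Normal x → padd p0 x ≡ x
  +-idˡP x nx = extΨ (padd p0 x) x (n-padd p0 x) nx λ G → trans (Ψ-padd G p0 x) (ZP.+-identityˡ _)

  +-invˡP : ∀ x → padd (pneg x) x ≡ p0
  +-invˡP x = extΨ (padd (pneg x) x) p0 (n-padd (pneg x) x) refl λ G →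
    trans (Ψ-padd G (pneg x) x) (trans (cong (Z._+ Ψ G x) (Ψ-pneg G x)) (ZP.+-inverseˡ (Ψ G x)))

  *-assocP : ∀ x y z → pmul (pmul x y) z ≡ pmul x (pmul y z)
  *-assocP x y z = extΨ (pmul (pmul x y) z) (pmul x (pmul y z)) (n-pmul (pmul x y) z) (n-pmul x (pmul y z)) λ G → begin
      Ψ G (pmul (pmul x y) z)
    ≡⟨ Ψ-pmul G (pmul x y) z ⟩
      Ψ (λ k → Ψ (λ l → G (k ⊛ l)) z) (pmul x y)
    ≡⟨ Ψ-pmul _ x y ⟩
      Φ (λ k → Ψ (λ m → Ψ (λ l → G ((k ⊛ m) ⊛ l)) z) y) (terms x)
    ≡⟨ Φ-cong (terms x) (λ k → Φ-cong (terms y) (λ m → Φ-cong (terms z) (λ l → cong G (⊛-assoc k m l)))) ⟩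
      Φ (λ k → Ψ (λ m → Ψ (λ l → G (k ⊛ (m ⊛ l))) z) y) (terms x)
    ≡⟨ Φ-cong (terms x) (λ k → sym (Ψ-pmul (λ n → G (k ⊛ n)) y z)) ⟩
      Φ (λ k → Ψ (λ n → G (k ⊛ n)) (pmul y z)) (terms x)
    ≡⟨ sym (Ψ-pmul G x (pmul y z)) ⟩
      Ψ G (pmul x (pmul y z)) ∎
    where open ≡-Reasoning

  *-commP : ∀ x y → pmul x y ≡ pmul y x
  *-commP x y = extΨ (pmul x y) (pmul y x) (n-pmul x y) (n-pmul y x) λ G →
    trans (Ψ-pmul G x y) (trans (Φ-swap (λ k l → G (k ⊛ l)) (terms x) (terms y))
    (trans (Φ-cong (terms y) (λ l → Φ-cong (terms x) (λ k → cong G (⊛-comm k l))))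
    (sym (Ψ-pmul G y x))))

  Ψ-scale : ∀ G c w → Ψ G (pmul (pconst c) w) ≡ c Z.* Ψ G w
  Ψ-scale G c w = trans (Ψ-pmul G (pconst c) w)
    (trans (Ψ-at (λ k → Ψ (λ l → G (k ⊛ l)) w) (pconst c) (c ∷ []) (at-norm (c ∷ [])))
    (trans (ZP.+-identityʳ _) (cong (c Z.*_) (Φ-cong (terms w) (λ l → cong G (NP.+-identityʳ l))))))

  at-scale : ∀ c w i → at (pmul (pconst c) w) i ≡ c Z.* at w i
  at-scale c w i = trans (at-Ψ (pmul (pconst c) w) i) (trans (Ψ-scale (δ i) c w) (cong (c Z.*_) (sym (at-Ψ w i))))

  *-idˡP : ∀ x → Normal x → pmul p1 x ≡ x
  *-idˡP x nx = ext (pmul p1 x) x (n-pmul p1 x) nx λ i → trans (at-scale 1ℤ x i) (ZP.*-identityˡ (at x i))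

  distribˡP : ∀ x y z → pmul x (padd y z) ≡ padd (pmul x y) (pmul x z)
  distribˡP x y z = extΨ (pmul x (padd y z)) (padd (pmul x y) (pmul x z)) (n-pmul x (padd y z)) (n-padd (pmul x y) (pmul x z)) λ G → begin
      Ψ G (pmul x (padd y z))
    ≡⟨ Ψ-pmul G x (padd y z) ⟩
      Φ (λ k → Ψ (λ l → G (k ⊛ l)) (padd y z)) (terms x)
    ≡⟨ Φ-cong (terms x) (λ k → Ψ-padd _ y z) ⟩
      Φ (λ k → Ψ (λ l → G (k ⊛ l)) y Z.+ Ψ (λ l → G (k ⊛ l)) z) (terms x)
    ≡⟨ Φ-+ _ _ (terms x) ⟩
      Φ (λ k → Ψ (λ l → G (k ⊛ l)) y) (terms x) Z.+ Φ (λ k → Ψ (λ l → G (k ⊛ l)) z) (terms x)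
    ≡⟨ sym (cong₂ Z._+_ (Ψ-pmul G x y) (Ψ-pmul G x z)) ⟩
      Ψ G (pmul x y) Z.+ Ψ G (pmul x z)
    ≡⟨ sym (Ψ-padd G (pmul x y) (pmul x z)) ⟩
      Ψ G (padd (pmul x y) (pmul x z)) ∎
    where open ≡-Reasoning


-- For a decidable prime
-- ideal P, if m and n are the last positions of x and y whose coefficients
-- lie outside P, then modulo P the coefficient of x·y at m ⊛ n is x_m·y_n,
-- which lies outside P.  With P = 0 this shows that ℤ[ℕ⁺] is a domain, with
-- P = rℤ it is Gauss' lemma.
module LeadingTerm where

  open SemigroupRing

  ⊛-mono-<-≤ : ∀ {i m j n} → i < m → j ≤ n → i ⊛ j < m ⊛ n
  ⊛-mono-<-≤ a b = NP.+-mono-<-≤ (NP.+-mono-<-≤ a b) (NP.*-mono-≤ (NP.<⇒≤ a) b)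

  ⊛-mono-≤-< : ∀ {i m j n} → i ≤ m → j < n → i ⊛ j < m ⊛ n
  ⊛-mono-≤-< a b = NP.+-mono-<-≤ (NP.+-mono-≤-< a b) (NP.*-mono-≤ a (NP.<⇒≤ b))

  record PIdeal : Set₁ where
    field
      P : ℤ → Set
      P? : ∀ x → Dec (P x)
      P0 : P 0ℤ
      P+ : ∀ {x y} → P x → P y → P (x Z.+ y)
      Pneg : ∀ {x} → P x → P (Z.- x)
      P*ʳ : ∀ {x} y → P x → P (x Z.* y)
      Pprime : ∀ {x y} → ¬ P x → ¬ P y → ¬ P (x Z.* y)

  module Ideal (I : PIdeal) where
    open PIdeal I public

    P*ˡ : ∀ x {y} → P y → P (x Z.* y)
    P*ˡ x {y} p = subst P (ZP.*-comm y x) (P*ʳ x p)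

    Pcong : ∀ {x y} → x ≡ y → P x → P y
    Pcong = subst P

    P- : ∀ {x y} → P x → P y → P (x Z.- y)
    P- px py = P+ px (Pneg py)

    P-trans : ∀ {x y z} → P (x Z.- y) → P (y Z.- z) → P (x Z.- z)
    P-trans {x} {y} {z} a b = Pcong (lem x y z) (P+ a b)
      where lem : ∀ x y z → x Z.- y Z.+ (y Z.- z) ≡ x Z.- z
            lem = solve-∀

    PΦ : ∀ G k xs → (∀ i → P (at xs i Z.* G (k N.+ i))) → P (Φ G (termsFrom k xs))
    PΦ G k [] h = P0
    PΦ G k (x ∷ xs) h = P+ (Pcong (cong (λ t → x Z.* G t) (NP.+-identityʳ k)) (h 0))
                           (PΦ G (suc k) xs (λ i → Pcong (cong (λ t → at xs i Z.* G t) (NP.+-suc k i)) (h (suc i))))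

    PΨ : ∀ G xs → (∀ i → P (at xs i Z.* G i)) → P (Ψ G xs)
    PΨ G xs h = PΦ G 0 xs h

    PΨ1 : ∀ G xs m → (∀ i → ¬ i ≡ m → P (at xs i Z.* G i)) → P (Ψ G xs Z.- at xs m Z.* G m)
    PΨ1 G xs m h = Pcong eq (PΨ G' xs h')
      where
      G' : ℕ → ℤ
      G' i = G i Z.- δ m i Z.* G i
      h' : ∀ i → P (at xs i Z.* G' i)
      h' i with m N.≟ i
      ... | yes refl = Pcong (sym (lem (at xs i) (G i))) P0
        where lem : ∀ a g → a Z.* (g Z.- 1ℤ Z.* g) ≡ 0ℤ
              lem = solve-∀
      ... | no ne = Pcong (sym (lem (at xs i) (G i))) (h i (λ e → ne (sym e)))
        where lem : ∀ a g → a Z.* (g Z.- 0ℤ Z.* g) ≡ a Z.* g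
              lem = solve-∀
      H : ℕ → ℤ
      H i = δ m i Z.* G i
      Hpt : ∀ i → H i ≡ G m Z.* δ m i
      Hpt i with m N.≟ i
      ... | yes refl = ZP.*-comm 1ℤ (G i)
      ... | no _ = trans (ZP.*-zeroˡ (G i)) (sym (ZP.*-zeroʳ (G m)))
      ΨH : Ψ H xs ≡ at xs m Z.* G m
      ΨH = trans (Φ-cong (terms xs) Hpt) (trans (Φ-* (G m) (δ m) (terms xs))
            (trans (cong (G m Z.*_) (sym (at-Ψ xs m))) (ZP.*-comm (G m) (at xs m))))
      eq : Ψ G' xs ≡ Ψ G xs Z.- at xs m Z.* G m
      eq = begin
          Ψ G' xs
        ≡⟨ Φ-+ G (λ i → Z.- H i) (terms xs) ⟩
          Ψ G xs Z.+ Φ (λ i → Z.- H i) (terms xs)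
        ≡⟨ cong (λ w → Ψ G xs Z.+ w) (trans (Φ-cong (terms xs) (λ i → nl (H i))) (trans (Φ-* (Z.- 1ℤ) H (terms xs)) (trans (cong (Z.- 1ℤ Z.*_) ΨH) (sym (nl _))))) ⟩
          Ψ G xs Z.- at xs m Z.* G m ∎
        where open ≡-Reasoning
              nl : ∀ h → Z.- h ≡ Z.- 1ℤ Z.* h
              nl = solve-∀

    data Top (xs : Poly) : Set where
      none : (∀ j → P (at xs j)) → Top xs
      some : ∀ m → ¬ P (at xs m) → (∀ j → m < j → P (at xs j)) → Top xs

    top : ∀ xs → Top xs
    top [] = none (λ j → P0)
    top (x ∷ xs) with top xs
    ... | some m nm above = some (suc m) nm (λ { (suc j) (s≤s lt) → above j lt })
    ... | none all with P? x
    ...   | yes px = none (λ { zero → px ; (suc j) → all j })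
    ...   | no npx = some 0 npx (λ { (suc j) _ → all j })

    at-pmul : ∀ x y K → at (pmul x y) K ≡ Ψ (λ i → Ψ (λ j → δ K (i ⊛ j)) y) x
    at-pmul x y K = trans (at-Ψ (pmul x y) K) (Ψ-pmul (δ K) x y)

    δ-lt : ∀ K a → a < K → δ K a ≡ 0ℤ
    δ-lt K a lt = δ-≢ K a (λ e → NP.<-irrefl (sym e) lt)

    mul-top : ∀ x y m n → ¬ P (at x m) → (∀ j → m < j → P (at x j)) →
              ¬ P (at y n) → (∀ j → n < j → P (at y j)) → ¬ P (at (pmul x y) (m ⊛ n))
    mul-top x y m n nx ax ny ay pK = Pprime nx ny xm*yn∈P
      where
      K = m ⊛ n
      -- G i is the coefficient at K of X_{i+1}·y
      G : ℕ → ℤ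
      G i = Ψ (λ j → δ K (i ⊛ j)) y
      -- only the term i = m of Σ_i x_i·G i survives modulo P
      row : P (Ψ G x Z.- at x m Z.* G m)
      row = PΨ1 G x m h
        where
        h : ∀ i → ¬ i ≡ m → P (at x i Z.* G i)
        h i ne with NP.<-cmp i m
        ... | tri≈ _ e _ = ⊥-elim (ne e)
        ... | tri> _ _ m<i = P*ʳ _ (ax i m<i)
        ... | tri< i<m _ _ = P*ˡ (at x i) (PΨ _ y inner)
          where
          inner : ∀ j → P (at y j Z.* δ K (i ⊛ j))
          inner j with NP.≤-<-connex j n
          ... | inj₂ n<j = P*ʳ _ (ay j n<j)
          ... | inj₁ j≤n = Pcong (sym (trans (cong (at y j Z.*_) (δ-lt K (i ⊛ j) (⊛-mono-<-≤ i<m j≤n))) (ZP.*-zeroʳ (at y j)))) P0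
      -- and G m ≡ y_n modulo P
      column : P (G m Z.- at y n)
      column = Pcong (cong (λ w → G m Z.- w) (trans (cong (at y n Z.*_) (δ-refl K)) (ZP.*-identityʳ _))) (PΨ1 _ y n h)
        where
        h : ∀ j → ¬ j ≡ n → P (at y j Z.* δ K (m ⊛ j))
        h j ne with NP.<-cmp j n
        ... | tri≈ _ e _ = ⊥-elim (ne e)
        ... | tri> _ _ n<j = P*ʳ _ (ay j n<j)
        ... | tri< j<n _ _ = Pcong (sym (trans (cong (at y j Z.*_) (δ-lt K (m ⊛ j) (⊛-mono-≤-< {m} {m} NP.≤-refl j<n))) (ZP.*-zeroʳ (at y j)))) P0
      scaled : P (at x m Z.* G m Z.- at x m Z.* at y n)
      scaled = Pcong (lem (at x m) (G m) (at y n)) (P*ˡ (at x m) column)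
        where lem : ∀ a g b → a Z.* (g Z.- b) ≡ a Z.* g Z.- a Z.* b
              lem = solve-∀
      xm*yn∈P : P (at x m Z.* at y n)
      xm*yn∈P = Pcong (lem (Ψ G x) (at x m Z.* at y n)) (P- (Pcong (at-pmul x y K) pK) (P-trans {Ψ G x} {at x m Z.* G m} {at x m Z.* at y n} row scaled))
        where lem : ∀ s t → s Z.- (s Z.- t) ≡ t
              lem = solve-∀


module Domain where

  open SemigroupRing
  open LeadingTerm

  ZeroI : PIdeal
  ZeroI = record
    { P = λ x → x ≡ 0ℤ
    ; P? = λ x → x Z.≟ 0ℤ
    ; P0 = refl
    ; P+ = λ { refl refl → refl }
    ; Pneg = λ { refl → refl }
    ; P*ʳ = λ { y refl → refl }
    ; Pprime = λ {x} {y} nx ny e → case0 nx ny (ZP.i*j≡0⇒i≡0∨j≡0 x e)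
    }
    where case0 : ∀ {A B : Set} → ¬ A → ¬ B → A ⊎ B → ⊥
          case0 na nb (inj₁ a) = na a
          case0 na nb (inj₂ b) = nb b

  PrimeI : (r : ℕ) → Prime r → PIdeal
  PrimeI r pr = record
    { P = λ x → (+ r) DS.∣ x
    ; P? = dec
    ; P0 = DS.divides 0ℤ refl
    ; P+ = DS.∣m∣n⇒∣m+n
    ; Pneg = DS.∣m⇒∣-m
    ; P*ʳ = λ y p → DS.∣m⇒∣m*n y p
    ; Pprime = pp
    }
    where
    dec : ∀ x → Dec ((+ r) DS.∣ x)
    dec x with r ND.∣? Z.∣ x ∣
    ... | yes d = yes (DS.∣ᵤ⇒∣ d)
    ... | no nd = no (λ d → nd (DS.∣⇒∣ᵤ d))
    pp : ∀ {x y} → ¬ (+ r) DS.∣ x → ¬ (+ r) DS.∣ y → ¬ (+ r) DS.∣ (x Z.* y)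
    pp {x} {y} nx ny d with euclidsLemma Z.∣ x ∣ Z.∣ y ∣ pr (subst (r ND.∣_) (ZP.abs-* x y) (DS.∣⇒∣ᵤ d))
    ... | inj₁ a = nx (DS.∣ᵤ⇒∣ a)
    ... | inj₂ b = ny (DS.∣ᵤ⇒∣ b)

  at-len : ∀ xs j → length xs ≤ j → at xs j ≡ 0ℤ
  at-len [] j _ = refl
  at-len (x ∷ xs) (suc j) (s≤s le) = at-len xs j le

  nz-idx : ∀ xs j → ¬ at xs j ≡ 0ℤ → j < length xs
  nz-idx xs j nz with NP.<-≤-connex j (length xs)
  ... | inj₁ lt = lt
  ... | inj₂ le = ⊥-elim (nz (at-len xs j le))

  last-nz : ∀ x xs → Normal (x ∷ xs) → ¬ at (x ∷ xs) (length xs) ≡ 0ℤ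
  last-nz x [] nx with x Z.≟ 0ℤ
  last-nz x [] () | yes _
  ... | no ne = ne
  last-nz x (y ∷ ys) nx = last-nz y ys (normal-tail x (y ∷ ys) nx)

  record TopZ (xs : Poly) : Set where
    constructor topz
    field
      m : ℕ
      nz : ¬ at xs m ≡ 0ℤ
      above : ∀ j → m < j → at xs j ≡ 0ℤ
      len : length xs ≡ suc m

  topZ : ∀ xs → Normal xs → ¬ xs ≡ [] → TopZ xs
  topZ [] _ ne = ⊥-elim (ne refl)
  topZ (x ∷ xs) nx _ = topz (length xs) (last-nz x xs nx) (λ j lt → at-len (x ∷ xs) j lt) refl

  open Ideal ZeroI using () renaming (mul-top to mul-topZ)

  mul-lenZ : ∀ x y → Normal x → Normal y → (tx : TopZ x) → (ty : TopZ y) →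
             ¬ at (pmul x y) (TopZ.m tx ⊛ TopZ.m ty) ≡ 0ℤ
  mul-lenZ x y nx ny (topz m nzx ax _) (topz n nzy ay _) = mul-topZ x y m n nzx ax nzy ay

  pmul-nz : ∀ x y → Normal x → Normal y → ¬ x ≡ [] → ¬ y ≡ [] → ¬ pmul x y ≡ []
  pmul-nz x y nx ny ex ey e = mul-lenZ x y nx ny tx ty (subst (λ l → at l (TopZ.m tx ⊛ TopZ.m ty) ≡ 0ℤ) (sym e) refl)
    where tx = topZ x nx ex
          ty = topZ y ny ey

  pmul-top : ∀ x y → Normal x → Normal y → (tx : TopZ x) → (ty : TopZ y) →
             TopZ.m tx ⊛ TopZ.m ty < length (pmul x y)
  pmul-top x y nx ny tx ty = nz-idx (pmul x y) _ (mul-lenZ x y nx ny tx ty)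

  at-pconst0 : ∀ z → at (pconst z) 0 ≡ z
  at-pconst0 z = at-norm (z ∷ []) 0

  const-ext : ∀ u → Normal u → length u ≤ 1 → u ≡ pconst (at u 0)
  const-ext u nu le = ext u (pconst (at u 0)) nu (n-pconst (at u 0)) f
    where
    f : ∀ i → at u i ≡ at (pconst (at u 0)) i
    f zero = sym (at-pconst0 _)
    f (suc i) = trans (at-len u (suc i) (NP.≤-trans le (s≤s z≤n))) (sym (trans (at-norm (at u 0 ∷ []) (suc i)) refl))

  pconst-mul : ∀ a b → pmul (pconst a) (pconst b) ≡ pconst (a Z.* b)
  pconst-mul a b = extΨ (pmul (pconst a) (pconst b)) (pconst (a Z.* b)) (n-pmul (pconst a) (pconst b)) (n-pconst (a Z.* b)) λ G →
    trans (Ψ-pmul G (pconst a) (pconst b))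
    (trans (Ψ-at _ (pconst a) (a ∷ []) (at-norm (a ∷ [])))
    (trans (cong (λ w → a Z.* w Z.+ 0ℤ) (Ψ-pconst (λ l → G (0 ⊛ l)) b))
    (trans (lem a b (G 0)) (sym (Ψ-pconst G (a Z.* b))))))
    where lem : ∀ a b g → a Z.* (b Z.* g) Z.+ 0ℤ ≡ a Z.* b Z.* g
          lem = solve-∀

  pconst-add : ∀ a b → padd (pconst a) (pconst b) ≡ pconst (a Z.+ b)
  pconst-add a b = extΨ (padd (pconst a) (pconst b)) (pconst (a Z.+ b)) (n-padd (pconst a) (pconst b)) (n-pconst (a Z.+ b)) λ G →
    trans (Ψ-padd G (pconst a) (pconst b)) (trans (cong₂ Z._+_ (Ψ-pconst G a) (Ψ-pconst G b))
    (trans (sym (ZP.*-distribʳ-+ (G 0) a b)) (sym (Ψ-pconst G (a Z.+ b)))))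

  pconst-inj : ∀ a b → pconst a ≡ pconst b → a ≡ b
  pconst-inj a b e = trans (sym (at-pconst0 a)) (trans (cong (λ l → at l 0) e) (at-pconst0 b))

  mul-const : ∀ x y → Normal x → Normal y → length (pmul x y) ≤ 1 → ¬ pmul x y ≡ [] →
              (x ≡ pconst (at x 0)) × (y ≡ pconst (at y 0))
  mul-const x y nx ny le ne = const-ext x nx lx , const-ext y ny ly
    where
    ex : ¬ x ≡ []
    ex refl = ne refl
    ey : ¬ y ≡ []
    ey refl = ne (*-commP x [])
    tx = topZ x nx ex
    ty = topZ y ny ey
    t = pmul-top x y nx ny tx ty
    m0 : TopZ.m tx ⊛ TopZ.m ty ≡ 0
    m0 = NP.n≤0⇒n≡0 (NP.≤-pred (NP.≤-trans t le))
    mx0 : TopZ.m tx ≡ 0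
    mx0 = NP.n≤0⇒n≡0 (subst (TopZ.m tx ≤_) m0 (NP.≤-trans (NP.m≤m+n _ _) (NP.m≤m+n _ _)))
    my0 : TopZ.m ty ≡ 0
    my0 = NP.n≤0⇒n≡0 (subst (TopZ.m ty ≤_) m0 (NP.≤-trans (NP.m≤n+m _ (TopZ.m tx)) (NP.m≤m+n _ _)))
    lx : length x ≤ 1
    lx = NP.≤-reflexive (trans (TopZ.len tx) (cong suc mx0))
    ly : length y ≤ 1
    ly = NP.≤-reflexive (trans (TopZ.len ty) (cong suc my0))


module Divisibility where

  open SemigroupRing
  open LeadingTerm
  open Domain

  module _ (r : ℕ) (pr : Prime r) where
    open Ideal (PrimeI r pr)
    gauss : ∀ a b → (∀ K → (+ r) DS.∣ at (pmul a b) K) →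
            (∀ j → (+ r) DS.∣ at a j) ⊎ (∀ j → (+ r) DS.∣ at b j)
    gauss a b h with top a | top b
    ... | none ha | _ = inj₁ ha
    ... | some _ _ _ | none hb = inj₂ hb
    ... | some m nm am | some n nn an = ⊥-elim (mul-top a b m n nm am nn an (h (m ⊛ n)))

  quotients : ∀ r a → (∀ j → (+ r) DS.∣ at a j) → Poly
  quotients r [] d = []
  quotients r (x ∷ xs) d = DS._∣_.quotient (d 0) ∷ quotients r xs (λ j → d (suc j))

  at-quotients : ∀ r a d j → at (quotients r a d) j Z.* (+ r) ≡ at a j
  at-quotients r [] d j = ZP.*-zeroˡ (+ r)
  at-quotients r (x ∷ xs) d zero = sym (DS._∣_.equality (d 0))
  at-quotients r (x ∷ xs) d (suc j) = at-quotients r xs (λ j → d (suc j)) j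

  divBy : ∀ r a → (∀ j → (+ r) DS.∣ at a j) → Poly
  divBy r a d = norm (quotients r a d)

  n-divBy : ∀ r a d → Normal (divBy r a d)
  n-divBy r a d = norm-idem (quotients r a d)

  at-divBy : ∀ r a d j → at (divBy r a d) j Z.* (+ r) ≡ at a j
  at-divBy r a d j = trans (cong (Z._* (+ r)) (at-norm (quotients r a d) j)) (at-quotients r a d j)

  divBy-spec : ∀ r a d → Normal a → pmul (pconst (+ r)) (divBy r a d) ≡ a
  divBy-spec r a d na = ext (pmul (pconst (+ r)) (divBy r a d)) a (n-pmul (pconst (+ r)) (divBy r a d)) na λ j →
    trans (at-scale (+ r) (divBy r a d) j) (trans (ZP.*-comm (+ r) _) (at-divBy r a d j))

  abs1 : ∀ a → Z.∣ a ∣ ≡ 1 → a ≡ 1ℤ ⊎ a ≡ Z.- 1ℤ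
  abs1 (+ .1) refl = inj₁ refl
  abs1 -[1+ 0 ] refl = inj₂ refl

  unitℤ : ∀ a b → a Z.* b ≡ 1ℤ → a ≡ 1ℤ ⊎ a ≡ Z.- 1ℤ
  unitℤ a b e = abs1 a (NP.m*n≡1⇒m≡1 Z.∣ a ∣ Z.∣ b ∣ (trans (sym (ZP.abs-* a b)) (cong Z.∣_∣ e)))

  primeℤ : ∀ p → Prime p → ∀ a b → a Z.* b ≡ + p → (a ≡ 1ℤ ⊎ a ≡ Z.- 1ℤ) ⊎ (b ≡ 1ℤ ⊎ b ≡ Z.- 1ℤ)
  primeℤ p pr a b e = cases (prime⇒irreducible pr (ND.divides Z.∣ b ∣ p≡∣b∣∣a∣))
    where
    p≡∣b∣∣a∣ : p ≡ Z.∣ b ∣ N.* Z.∣ a ∣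
    p≡∣b∣∣a∣ = trans (sym (cong Z.∣_∣ e)) (trans (ZP.abs-* a b) (NP.*-comm Z.∣ a ∣ Z.∣ b ∣))
    cases : Z.∣ a ∣ ≡ 1 ⊎ Z.∣ a ∣ ≡ p → (a ≡ 1ℤ ⊎ a ≡ Z.- 1ℤ) ⊎ (b ≡ 1ℤ ⊎ b ≡ Z.- 1ℤ)
    cases (inj₁ ∣a∣≡1) = inj₁ (abs1 a ∣a∣≡1)
    cases (inj₂ ∣a∣≡p) = inj₂ (abs1 b (NP.*-cancelʳ-≡ Z.∣ b ∣ 1 p {{prime⇒nonZero pr}} ∣b∣p≡1p))
      where
      ∣b∣p≡1p : Z.∣ b ∣ N.* p ≡ 1 N.* p
      ∣b∣p≡1p = begin
          Z.∣ b ∣ N.* p           ≡⟨ NP.*-comm Z.∣ b ∣ p ⟩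
          p N.* Z.∣ b ∣           ≡⟨ cong (N._* Z.∣ b ∣) (sym ∣a∣≡p) ⟩
          Z.∣ a ∣ N.* Z.∣ b ∣     ≡⟨ sym (ZP.abs-* a b) ⟩
          Z.∣ a Z.* b ∣           ≡⟨ cong Z.∣_∣ e ⟩
          p                       ≡⟨ sym (NP.*-identityˡ p) ⟩
          1 N.* p ∎
        where open ≡-Reasoning

  prime∣factorial : ∀ q m → Prime q → q ≤ m → q ND.∣ m !
  prime∣factorial (suc q) m _ le = ND.∣-trans (ND.divides (q !) (NP.*-comm (suc q) (q !))) (ND.m≤n⇒m!∣n! le)

  -- Euclid: every prime factor of m! + 1 exceeds m
  bigPrime : ∀ m → Σ ℕ λ q → Prime q × m < q
  bigPrime m = go (PrimeFactorisation.factors F) (PrimeFactorisation.isFactorisation F) (PrimeFactorisation.factorsPrime F)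
    where
    instance _ = N.>-nonZero (NP.m≤n+m 1 (m !))
    n = m ! N.+ 1
    F = factorise n
    go : ∀ fs → n ≡ product fs → All Prime fs → Σ ℕ λ q → Prime q × m < q
    go [] e _ = ⊥-elim (NP.<⇒≢ (NP.1≤n! m) (sym (NP.+-cancelʳ-≡ 1 (m !) 0 e)))
    go (q ∷ fs) e (pq ∷ _) with m N.<? q
    ... | yes lt = q , pq , lt
    ... | no nlt = ⊥-elim (¬prime[1] (subst Prime (ND.∣1⇒≡1 q∣1) pq))
      where
      q∣n : q ND.∣ n
      q∣n = ND.divides (product fs) (trans e (NP.*-comm q (product fs)))
      q∣1 : q ND.∣ 1
      q∣1 = ND.∣m+n∣m⇒∣n q∣n (prime∣factorial q m pq (NP.≮⇒≥ nlt))


-- The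
-- evaluations E t (X_n ↦ n^t) are ring homomorphisms ℤ[ℕ⁺] → ℤ.  For large t
-- the top term of a dominates, so E t a ≠ 0 and |E t b| ≤ |E t a| for every
-- divisor b.  Applying the operators (X_n ↦ (n - c)·X_n) for all c ≤ length a
-- except c = m + 1 isolates the coefficient b_m, and since E t of such an
-- image is a fixed combination of E t', E (t+1), …, b_m is bounded too.
module DivisorBound where

  open Z using (∣_∣)

  open SemigroupRing
  open LeadingTerm
  open Domain
  open Divisibility

  *-^ : ∀ m n t → (m N.* n) ^ t ≡ m ^ t N.* n ^ t
  *-^ m n zero = refl
  *-^ m n (suc t) rewrite *-^ m n t = lem m n (m ^ t) (n ^ t)
    where lem : ∀ m n a b → m N.* n N.* (a N.* b) ≡ m N.* a N.* (n N.* b)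
          lem = solve-∀ℕ

  pw : ℕ → ℕ → ℤ
  pw t k = + (suc k ^ t)

  E : ℕ → Poly → ℤ
  E t xs = Ψ (pw t) xs

  pw-⊛ : ∀ t k l → pw t (k ⊛ l) ≡ pw t k Z.* pw t l
  pw-⊛ t k l = trans (cong (λ z → + (z ^ t)) (⊛-suc k l)) (trans (cong +_ (*-^ (suc k) (suc l) t)) (ZP.pos-* (suc k ^ t) (suc l ^ t)))

  E-hom : ∀ t x y → E t (pmul x y) ≡ E t x Z.* E t y
  E-hom t x y = trans (Ψ-pmul (pw t) x y)
    (trans (Φ-cong (terms x) (λ k → trans (Φ-cong (terms y) (λ l → pw-⊛ t k l)) (Φ-* (pw t k) (pw t) (terms y))))
    (trans (Φ-cong (terms x) (λ k → ZP.*-comm (pw t k) (E t y))) (trans (Φ-* (E t y) (pw t) (terms x)) (ZP.*-comm (E t y) (E t x)))))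

  absSum : Poly → ℕ
  absSum [] = 0
  absSum (x ∷ xs) = ∣ x ∣ N.+ absSum xs

  Φbound : ∀ G k xs M → (∀ i → ∣ at xs i Z.* G (k N.+ i) ∣ ≤ ∣ at xs i ∣ N.* M) →
           ∣ Φ G (termsFrom k xs) ∣ ≤ absSum xs N.* M
  Φbound G k [] M h = z≤n
  Φbound G k (x ∷ xs) M h = NP.≤-trans (ZP.∣i+j∣≤∣i∣+∣j∣ (x Z.* G k) _)
    (NP.≤-trans (NP.+-mono-≤ (subst (λ z → ∣ x Z.* G z ∣ ≤ ∣ x ∣ N.* M) (NP.+-identityʳ k) (h 0))
                             (Φbound G (suc k) xs M (λ i → subst (λ z → ∣ at xs i Z.* G z ∣ ≤ ∣ at xs i ∣ N.* M) (NP.+-suc k i) (h (suc i)))))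
     (NP.≤-reflexive (sym (NP.*-distribʳ-+ M ∣ x ∣ (absSum xs)))))

  Ψbound : ∀ G xs M → (∀ i → ∣ at xs i Z.* G i ∣ ≤ ∣ at xs i ∣ N.* M) → ∣ Ψ G xs ∣ ≤ absSum xs N.* M
  Ψbound G xs M h = Φbound G 0 xs M h

  E-bound : ∀ t xs → ∣ E t xs ∣ ≤ absSum xs N.* (length xs ^ t)
  E-bound t xs = Ψbound (pw t) xs (length xs ^ t) h
    where
    h : ∀ i → ∣ at xs i Z.* pw t i ∣ ≤ ∣ at xs i ∣ N.* (length xs ^ t)
    h i with i N.<? length xs
    ... | yes lt = NP.≤-trans (NP.≤-reflexive (ZP.abs-* (at xs i) (pw t i))) (NP.*-monoʳ-≤ ∣ at xs i ∣ (NP.^-monoˡ-≤ t lt))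
    ... | no nlt rewrite at-len xs i (NP.≮⇒≥ nlt) = z≤n

  -- the operator X_n ↦ (n - c)·X_n; under evaluation it becomes E (t+1) - c·E t
  opFrom : ℕ → ℕ → Poly → Poly
  opFrom k c [] = []
  opFrom k c (x ∷ xs) = x Z.* (+ suc k Z.- + c) ∷ opFrom (suc k) c xs

  op : ℕ → Poly → Poly
  op c xs = opFrom 0 c xs

  Φ-op : ∀ t k c xs → Φ (pw (suc t)) (termsFrom k xs) Z.- + c Z.* Φ (pw t) (termsFrom k xs) ≡ Φ (pw t) (termsFrom k (opFrom k c xs))
  Φ-op t k c [] = lem (+ c)
    where lem : ∀ c → 0ℤ Z.- c Z.* 0ℤ ≡ 0ℤ
          lem = solve-∀
  Φ-op t k c (x ∷ xs) =
    trans (cong (λ z → x Z.* z Z.+ A Z.- + c Z.* (x Z.* pw t k Z.+ B)) (ZP.pos-* (suc k) (suc k ^ t)))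
    (trans (lem x (+ suc k) (pw t k) (+ c) A B)
    (cong (λ w → x Z.* (+ suc k Z.- + c) Z.* pw t k Z.+ w) (Φ-op t (suc k) c xs)))
    where
    A = Φ (pw (suc t)) (termsFrom (suc k) xs)
    B = Φ (pw t) (termsFrom (suc k) xs)
    lem : ∀ x K P c A B → x Z.* (K Z.* P) Z.+ A Z.- c Z.* (x Z.* P Z.+ B) ≡ x Z.* (K Z.- c) Z.* P Z.+ (A Z.- c Z.* B)
    lem = solve-∀

  E-op : ∀ t c xs → E (suc t) xs Z.- + c Z.* E t xs ≡ E t (op c xs)
  E-op t c xs = Φ-op t 0 c xs

  at-opFrom : ∀ k c xs i → at (opFrom k c xs) i ≡ at xs i Z.* (+ suc (k N.+ i) Z.- + c)
  at-opFrom k c [] i = refl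
  at-opFrom k c (x ∷ xs) zero rewrite NP.+-identityʳ k = refl
  at-opFrom k c (x ∷ xs) (suc i) rewrite NP.+-suc k i = at-opFrom (suc k) c xs i

  -- a Bernoulli-type inequality, used to show that (m+1)^t eventually dominates S·m^t
  bern : ∀ m t → m ^ suc t N.+ t N.* m ^ t ≤ m N.* suc m ^ t
  bern m zero = NP.≤-reflexive (NP.+-identityʳ _)
  bern m (suc t) = begin
      m ^ suc (suc t) N.+ suc t N.* m ^ suc t
    ≤⟨ NP.m≤m+n _ (t N.* m ^ t) ⟩
      m ^ suc (suc t) N.+ suc t N.* m ^ suc t N.+ t N.* m ^ t
    ≡⟨ lem m (m ^ t) t ⟩
      suc m N.* (m ^ suc t N.+ t N.* m ^ t)
    ≤⟨ NP.*-monoʳ-≤ (suc m) (bern m t) ⟩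
      suc m N.* (m N.* suc m ^ t)
    ≡⟨ lem2 m (suc m ^ t) ⟩
      m N.* suc m ^ suc t ∎
    where
    open NP.≤-Reasoning
    lem : ∀ m a t → m N.* (m N.* a) N.+ suc t N.* (m N.* a) N.+ t N.* a ≡ suc m N.* (m N.* a N.+ t N.* a)
    lem = solve-∀ℕ
    lem2 : ∀ m b → suc m N.* (m N.* b) ≡ m N.* (suc m N.* b)
    lem2 = solve-∀ℕ

  dominate : ∀ m S t → S N.* suc m ≤ t → S N.* m ^ t < suc m ^ t
  dominate zero zero t le = NP.m^n>0 1 t
  dominate zero (suc S) zero ()
  dominate zero (suc S) (suc t) le = subst (N._< 1 ^ suc t) (sym (NP.*-zeroʳ (suc S))) (NP.m^n>0 1 (suc t))
  dominate (suc m) S t le = NP.*-cancelˡ-< (suc m) (S N.* suc m ^ t) (suc (suc m) ^ t) step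
    where
    open NP.≤-Reasoning
    step : suc m N.* (S N.* suc m ^ t) < suc m N.* suc (suc m) ^ t
    step = begin-strict
        suc m N.* (S N.* suc m ^ t)
      ≡⟨ lem (suc m) S (suc m ^ t) ⟩
        S N.* suc m N.* suc m ^ t
      <⟨ NP.m<n+m (S N.* suc m N.* suc m ^ t) (NP.m^n>0 (suc m) (suc t)) ⟩
        suc m ^ suc t N.+ S N.* suc m N.* suc m ^ t
      ≤⟨ NP.+-monoʳ-≤ (suc m ^ suc t) (NP.*-monoˡ-≤ (suc m ^ t) (NP.≤-trans (NP.*-monoʳ-≤ S (NP.n≤1+n (suc m))) le)) ⟩
        suc m ^ suc t N.+ t N.* suc m ^ t
      ≤⟨ bern (suc m) t ⟩
        suc m N.* suc (suc m) ^ t ∎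
      where lem : ∀ a S b → a N.* (S N.* b) ≡ S N.* a N.* b
            lem = solve-∀ℕ

  snoc : ∀ a → ¬ a ≡ [] → Σ Poly λ a' → Σ ℤ λ x → a ≡ a' ++ x ∷ []
  snoc [] ne = ⊥-elim (ne refl)
  snoc (y ∷ []) ne = [] , y , refl
  snoc (y ∷ z ∷ zs) ne with snoc (z ∷ zs) (λ ())
  ... | a' , x , e = y ∷ a' , x , cong (y ∷_) e

  termsFrom-++ : ∀ k xs ys → termsFrom k (xs ++ ys) ≡ termsFrom k xs ++ termsFrom (k N.+ length xs) ys
  termsFrom-++ k [] ys = cong (λ z → termsFrom z ys) (sym (NP.+-identityʳ k))
  termsFrom-++ k (x ∷ xs) ys = cong ((k , x) ∷_) (trans (termsFrom-++ (suc k) xs ys) (cong (λ z → termsFrom (suc k) xs ++ termsFrom z ys) (sym (NP.+-suc k (length xs)))))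

  E-snoc : ∀ t a' x → E t (a' ++ x ∷ []) ≡ E t a' Z.+ (x Z.* pw t (length a') Z.+ 0ℤ)
  E-snoc t a' x = trans (cong (Φ (pw t)) (termsFrom-++ 0 a' (x ∷ []))) (Φ-++ (pw t) (termsFrom 0 a') _)

  absSum-snoc : ∀ a' x → absSum a' ≤ absSum (a' ++ x ∷ [])
  absSum-snoc [] x = z≤n
  absSum-snoc (y ∷ a') x = NP.+-monoʳ-≤ ∣ y ∣ (absSum-snoc a' x)

  len-snoc : ∀ (a' : Poly) (x : ℤ) → length (a' ++ x ∷ []) ≡ suc (length a')
  len-snoc [] x = refl
  len-snoc (y ∷ a') x = cong suc (len-snoc a' x)

  snoc-nz : ∀ a' x → Normal (a' ++ x ∷ []) → ¬ x ≡ 0ℤ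
  snoc-nz [] x n with x Z.≟ 0ℤ
  snoc-nz [] x () | yes _
  ... | no ne = ne
  snoc-nz (y ∷ a') x n = snoc-nz a' x (normal-tail y (a' ++ x ∷ []) n)

  -- for t ≥ |a|₁·length a the top term of a dominates E t a, so E t a ≠ 0
  nonvanish : ∀ a → Normal a → ¬ a ≡ [] → ∀ t → absSum a N.* length a ≤ t → ¬ E t a ≡ 0ℤ
  nonvanish a na ne t le e0 with snoc a ne
  ... | a' , x , refl = NP.<-irrefl eqabs (NP.<-≤-trans (NP.≤-<-trans b1 b2) b3)
    where
    m = length a'
    S = absSum (a' ++ x ∷ [])
    R = E t a'
    L = x Z.* pw t m
    eq0 : R Z.+ (L Z.+ 0ℤ) ≡ 0ℤ
    eq0 = trans (sym (E-snoc t a' x)) e0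
    eqabs : ∣ R ∣ ≡ ∣ L ∣
    eqabs = trans (cong ∣_∣ (lem R L eq0)) (ZP.∣-i∣≡∣i∣ L)
      where lem : ∀ R L → R Z.+ (L Z.+ 0ℤ) ≡ 0ℤ → R ≡ Z.- L
            lem R L e = trans (sym (l2 R L)) (trans (cong (Z._+ Z.- L) e) (ZP.+-identityˡ (Z.- L)))
              where l2 : ∀ R L → R Z.+ (L Z.+ 0ℤ) Z.+ Z.- L ≡ R
                    l2 = solve-∀
    b1 : ∣ R ∣ ≤ S N.* m ^ t
    b1 = NP.≤-trans (E-bound t a') (NP.*-monoˡ-≤ (m ^ t) (absSum-snoc a' x))
    b2 : S N.* m ^ t < suc m ^ t
    b2 = dominate m S t (subst (λ z → S N.* z ≤ t) (len-snoc a' x) le)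
    b3 : suc m ^ t ≤ ∣ L ∣
    b3 = subst (suc m ^ t ≤_) (sym (ZP.abs-* x (pw t m)))
          (NP.m≤n*m (suc m ^ t) ∣ x ∣ {{N.≢-nonZero (λ e → snoc-nz a' x na (ZP.∣i∣≡0⇒i≡0 e))}})

  opAll : List ℕ → Poly → Poly
  opAll [] xs = xs
  opAll (c ∷ cs) xs = op c (opAll cs xs)

  prodF : List ℕ → ℕ → ℤ
  prodF [] i = 1ℤ
  prodF (c ∷ cs) i = prodF cs i Z.* (+ suc i Z.- + c)

  prodB : List ℕ → ℕ
  prodB [] = 1
  prodB (c ∷ cs) = prodB cs N.* suc c

  at-opAll : ∀ cs xs i → at (opAll cs xs) i ≡ at xs i Z.* prodF cs i
  at-opAll [] xs i = sym (ZP.*-identityʳ _)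
  at-opAll (c ∷ cs) xs i = trans (at-opFrom 0 c (opAll cs xs) i)
    (trans (cong (Z._* (+ suc i Z.- + c)) (at-opAll cs xs i)) (ZP.*-assoc (at xs i) (prodF cs i) _))

  absSub : ∀ a c b → ∣ a Z.- + c Z.* b ∣ ≤ ∣ a ∣ N.+ c N.* ∣ b ∣
  absSub a c b = NP.≤-trans (ZP.∣i-j∣≤∣i∣+∣j∣ a (+ c Z.* b)) (NP.≤-reflexive (cong (∣ a ∣ N.+_) (ZP.abs-* (+ c) b)))

  iterB : ∀ cs xs T n V → (∀ j → j ≤ length cs N.+ n → ∣ E (T N.+ j) xs ∣ ≤ V) →
          ∀ j → j ≤ n → ∣ E (T N.+ j) (opAll cs xs) ∣ ≤ V N.* prodB cs
  iterB [] xs T n V h j le = NP.≤-trans (h j le) (NP.≤-reflexive (sym (NP.*-identityʳ V)))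
  iterB (c ∷ cs) xs T n V h j le = begin
      ∣ E (T N.+ j) (op c Y) ∣
    ≡⟨ cong ∣_∣ (sym (E-op (T N.+ j) c Y)) ⟩
      ∣ E (suc (T N.+ j)) Y Z.- + c Z.* E (T N.+ j) Y ∣
    ≤⟨ absSub (E (suc (T N.+ j)) Y) c (E (T N.+ j) Y) ⟩
      ∣ E (suc (T N.+ j)) Y ∣ N.+ c N.* ∣ E (T N.+ j) Y ∣
    ≤⟨ NP.+-mono-≤ (subst (λ z → ∣ E z Y ∣ ≤ W) (NP.+-suc T j) (ih (suc j) (s≤s le)))
                   (NP.*-monoʳ-≤ c (ih j (NP.m≤n⇒m≤1+n le))) ⟩
      W N.+ c N.* W
    ≡⟨ lem V (prodB cs) c ⟩
      V N.* prodB (c ∷ cs) ∎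
    where
    open NP.≤-Reasoning
    Y = opAll cs xs
    W = V N.* prodB cs
    ih : ∀ j → j ≤ suc n → ∣ E (T N.+ j) Y ∣ ≤ W
    ih = iterB cs xs T (suc n) V (λ j le' → h j (subst (j ≤_) (NP.+-suc (length cs) n) le'))
    lem : ∀ V P c → V N.* P N.+ c N.* (V N.* P) ≡ V N.* (P N.* suc c)
    lem = solve-∀ℕ

  -- the list K, K-1, …, 1 with m + 1 removed: opAll (ex K m) kills every coefficient
  -- at positions i < K other than m, and keeps the m-th one nonzero
  ex : ℕ → ℕ → List ℕ
  ex zero m = []
  ex (suc K) m with K N.≟ m
  ... | yes _ = ex K m
  ... | no _ = suc K ∷ ex K m

  ex-len : ∀ K m → length (ex K m) ≤ K
  ex-len zero m = z≤n
  ex-len (suc K) m with K N.≟ m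
  ... | yes _ = NP.m≤n⇒m≤1+n (ex-len K m)
  ... | no _ = s≤s (ex-len K m)

  ex-B : ∀ K m → prodB (ex K m) ≤ suc K ^ K
  ex-B zero m = s≤s z≤n
  ex-B (suc K) m with K N.≟ m
  ... | yes _ = NP.≤-trans (ex-B K m) (NP.≤-trans (NP.^-monoˡ-≤ K (NP.n≤1+n (suc K))) (NP.^-monoʳ-≤ (suc (suc K)) (NP.n≤1+n K)))
  ... | no _ = NP.≤-trans (NP.*-mono-≤ (NP.≤-trans (ex-B K m) (NP.^-monoˡ-≤ K (NP.n≤1+n (suc K)))) (NP.≤-refl {suc (suc K)}))
                         (NP.≤-reflexive (NP.*-comm (suc (suc K) ^ K) (suc (suc K))))

  sub0 : ∀ a b → + a Z.- + b ≡ 0ℤ → a ≡ b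
  sub0 a b e = ZP.+-injective (ZP.i-j≡0⇒i≡j (+ a) (+ b) e)

  ex-zero : ∀ K m i → i < K → ¬ i ≡ m → prodF (ex K m) i ≡ 0ℤ
  ex-zero (suc K) m i lt ne with K N.≟ m
  ... | yes refl = ex-zero K m i (NP.≤∧≢⇒< (NP.≤-pred lt) (λ e → ne (trans e refl))) ne
  ... | no _ with i N.≟ K
  ...   | yes refl = trans (cong (prodF (ex i m) i Z.*_) (ZP.i≡j⇒i-j≡0 {+ suc i} refl)) (ZP.*-zeroʳ (prodF (ex i m) i))
  ...   | no ni = trans (cong (Z._* (+ suc i Z.- + suc K)) (ex-zero K m i (NP.≤∧≢⇒< (NP.≤-pred lt) ni) ne)) (ZP.*-zeroˡ (+ suc i Z.- + suc K))

  ex-nz : ∀ K m → ¬ prodF (ex K m) m ≡ 0ℤ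
  ex-nz zero m ()
  ex-nz (suc K) m with K N.≟ m
  ... | yes _ = ex-nz K m
  ... | no ne = λ e → case0 (ZP.i*j≡0⇒i≡0∨j≡0 (prodF (ex K m) m) e)
    where
    case0 : prodF (ex K m) m ≡ 0ℤ ⊎ (+ suc m Z.- + suc K) ≡ 0ℤ → ⊥
    case0 (inj₁ x) = ex-nz K m x
    case0 (inj₂ y) = ne (sym (NP.suc-injective (sub0 (suc m) (suc K) y)))

  single : ∀ xs m → (∀ i → ¬ i ≡ m → at xs i ≡ 0ℤ) → ∀ G → Ψ G xs ≡ at xs m Z.* G m
  single xs m h G = ZP.i-j≡0⇒i≡j _ _ (PΨ1 G xs m (λ i ne → trans (cong (Z._* G i) (h i ne)) (ZP.*-zeroˡ (G i))))
    where open Ideal ZeroI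

  absLe : ∀ x y z → x Z.* y ≡ z → ¬ z ≡ 0ℤ → ∣ x ∣ ≤ ∣ z ∣
  absLe x y z e nz = subst (∣ x ∣ ≤_) (trans (sym (ZP.abs-* x y)) (cong ∣_∣ e))
    (NP.m≤m*n ∣ x ∣ ∣ y ∣ {{N.≢-nonZero (λ y0 → nz (trans (sym e) (trans (cong (x Z.*_) (ZP.∣i∣≡0⇒i≡0 y0)) (ZP.*-zeroʳ x))))}})

  isolate : ∀ b M m → length b ≤ M → ∀ t → ∣ at b m ∣ ≤ ∣ E t (opAll (ex M m) b) ∣
  isolate b M m lenb t = begin
      ∣ at b m ∣
    ≤⟨ NP.m≤m*n ∣ at b m ∣ ∣ prodF cs m ∣ {{N.≢-nonZero (λ z → ex-nz M m (ZP.∣i∣≡0⇒i≡0 z))}} ⟩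
      ∣ at b m ∣ N.* ∣ prodF cs m ∣
    ≡⟨ sym (ZP.abs-* (at b m) (prodF cs m)) ⟩
      ∣ at b m Z.* prodF cs m ∣
    ≤⟨ NP.m≤m*n _ ∣ pw t m ∣ {{NP.m^n≢0 (suc m) t}} ⟩
      ∣ at b m Z.* prodF cs m ∣ N.* ∣ pw t m ∣
    ≡⟨ sym (ZP.abs-* (at b m Z.* prodF cs m) (pw t m)) ⟩
      ∣ at b m Z.* prodF cs m Z.* pw t m ∣
    ≡⟨ cong ∣_∣ (sym (trans (single Y m zero-else (pw t)) (cong (Z._* pw t m) (at-opAll cs b m)))) ⟩
      ∣ E t Y ∣ ∎
    where
    open NP.≤-Reasoning
    cs = ex M m
    Y = opAll cs b
    zero-else : ∀ i → ¬ i ≡ m → at Y i ≡ 0ℤ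
    zero-else i i≢m with i N.<? M
    ... | yes i<M = trans (at-opAll cs b i) (trans (cong (at b i Z.*_) (ex-zero M m i i<M i≢m)) (ZP.*-zeroʳ (at b i)))
    ... | no i≮M = trans (at-opAll cs b i) (trans (cong (Z._* prodF cs i) (at-len b i (NP.≤-trans lenb (NP.≮⇒≥ i≮M)))) (ZP.*-zeroˡ (prodF cs i)))

  divisor-length : ∀ a b c → Normal b → Normal c → ¬ a ≡ [] → pmul b c ≡ a → length b ≤ length a
  divisor-length a b c nb nc ne e = subst (λ z → length b ≤ length z) e (begin
      length b                ≡⟨ TopZ.len tb ⟩
      suc (TopZ.m tb)         ≤⟨ s≤s (NP.≤-trans (NP.m≤m+n (TopZ.m tb) (TopZ.m tc)) (NP.m≤m+n _ _)) ⟩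
      suc (TopZ.m tb ⊛ TopZ.m tc) ≤⟨ pmul-top b c nb nc tb tc ⟩
      length (pmul b c) ∎)
    where
    open NP.≤-Reasoning
    tb = topZ b nb (λ { refl → ne (sym e) })
    tc = topZ c nc (λ { refl → ne (trans (sym e) (*-commP b [])) })

  divisor-eval : ∀ a b c → Normal a → ¬ a ≡ [] → pmul b c ≡ a →
                 ∀ t → absSum a N.* length a ≤ t → ∣ E t b ∣ ≤ absSum a N.* length a ^ t
  divisor-eval a b c na ne e t le =
    NP.≤-trans (absLe (E t b) (E t c) (E t a) (trans (sym (E-hom t b c)) (cong (E t) e)) (nonvanish a na ne t le))
               (E-bound t a)

  Bd : Poly → ℕ
  Bd a = absSum a N.* (length a ^ (absSum a N.* length a N.+ length a)) N.* (suc (length a) ^ length a)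

  divBound : ∀ a b c → Normal a → Normal b → Normal c → ¬ a ≡ [] → pmul b c ≡ a →
             (length b ≤ length a) × (∀ i → ∣ at b i ∣ ≤ Bd a)
  divBound a b c na nb nc ne e = lenb , bnd
    where
    M = length a
    T₀ = absSum a N.* M
    V = absSum a N.* M ^ (T₀ N.+ M)
    lenb : length b ≤ M
    lenb = divisor-length a b c nb nc ne e
    instance
      M≢0 : N.NonZero M
      M≢0 = N.≢-nonZero (λ len≡0 → ne (nil a len≡0))
        where nil : ∀ (a : Poly) → length a ≡ 0 → a ≡ []
              nil [] _ = refl
    bnd : ∀ m → ∣ at b m ∣ ≤ Bd a
    bnd m = begin
        ∣ at b m ∣                          ≤⟨ isolate b M m lenb (T₀ N.+ 0) ⟩
        ∣ E (T₀ N.+ 0) (opAll cs b) ∣       ≤⟨ iterB cs b T₀ 0 V hyp 0 z≤n ⟩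
        V N.* prodB cs                      ≤⟨ NP.*-monoʳ-≤ V (ex-B M m) ⟩
        Bd a ∎
      where
      open NP.≤-Reasoning
      cs = ex M m
      hyp : ∀ j → j ≤ length cs N.+ 0 → ∣ E (T₀ N.+ j) b ∣ ≤ V
      hyp j le = NP.≤-trans (divisor-eval a b c na ne e (T₀ N.+ j) (NP.m≤m+n T₀ j))
                 (NP.*-monoʳ-≤ (absSum a) (NP.^-monoʳ-≤ M (NP.+-monoʳ-≤ T₀
                   (NP.≤-trans (subst (j ≤_) (NP.+-identityʳ _) le) (ex-len M m)))))


-- An injective coding of coefficient lists by natural numbers (via binary
-- numerals), used to realise A as a computable subset of ℕ.
module Encoding where

  open SemigroupRing
  open import Data.Nat.Binary as B using (ℕᵇ; zero; 2[1+_]; 1+[2_])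
  import Data.Nat.Binary.Properties as BP

  ones : ℕ → ℕᵇ → ℕᵇ
  ones zero b = b
  ones (suc k) b = 1+[2 ones k b ]

  -- an entry + n or -[1+ n ] becomes n digits 1 followed by a two-digit sign tag
  encB : Poly → ℕᵇ
  encB [] = zero
  encB (+ n ∷ xs) = ones n (2[1+ 2[1+ encB xs ] ])
  encB (-[1+ n ] ∷ xs) = ones n (2[1+ 1+[2 encB xs ] ])

  -- decoding reads the digits back; a digit 1 increments the entry being read
  incHead : Poly → Poly
  incHead [] = []
  incHead (+ n ∷ xs) = + suc n ∷ xs
  incHead (-[1+ n ] ∷ xs) = -[1+ suc n ] ∷ xs

  decB : ℕᵇ → Poly
  decB zero = []
  decB 1+[2 b ] = incHead (decB b)
  decB 2[1+ zero ] = []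
  decB 2[1+ 2[1+ r ] ] = + 0 ∷ decB r
  decB 2[1+ 1+[2 r ] ] = -[1+ 0 ] ∷ decB r

  dec-ones+ : ∀ k r → decB (ones k (2[1+ 2[1+ r ] ])) ≡ + k ∷ decB r
  dec-ones+ zero r = refl
  dec-ones+ (suc k) r rewrite dec-ones+ k r = refl

  dec-ones- : ∀ k r → decB (ones k (2[1+ 1+[2 r ] ])) ≡ -[1+ k ] ∷ decB r
  dec-ones- zero r = refl
  dec-ones- (suc k) r rewrite dec-ones- k r = refl

  decB-encB : ∀ xs → decB (encB xs) ≡ xs
  decB-encB [] = refl
  decB-encB (+ n ∷ xs) = trans (dec-ones+ n (encB xs)) (cong (+ n ∷_) (decB-encB xs))
  decB-encB (-[1+ n ] ∷ xs) = trans (dec-ones- n (encB xs)) (cong (-[1+ n ] ∷_) (decB-encB xs))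

  enc : Poly → ℕ
  enc xs = B.toℕ (encB xs)

  dec : ℕ → Poly
  dec n = decB (B.fromℕ n)

  dec-enc : ∀ xs → dec (enc xs) ≡ xs
  dec-enc xs = trans (cong decB (BP.fromℕ-toℕ (encB xs))) (decB-encB xs)


module Construction (R : ℕ → ℕ → Bool) where

  open SemigroupRing
  open LeadingTerm
  open Domain
  open Divisibility
  open DivisorBound
  open Encoding

  -- A prime p is active at position i (key q = i + 1) when
  -- p ≤ q and some s ≤ q witnesses primesBelow p ∈ S; A consists of the
  -- elements whose coefficient at every prime key q is divisible by all
  -- primes active there.
  module Subring where

    Act : ℕ → ℕ → Set
    Act p q = Prime p × p ≤ q × Σ ℕ (λ s → s ≤ q × R s (primesBelow p) ≡ true)

    InA : Poly → Set
    InA xs = ∀ i p → Prime (suc i) → Act p (suc i) → (+ p) DS.∣ at xs i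

    Act? : ∀ p q → Dec (Act p q)
    Act? p q with prime? p | p N.≤? q | NP.anyUpTo? (λ s → R s (primesBelow p) ≟ᵇ true) (suc q)
    ... | no np | _ | _ = no (λ a → np (proj₁ a))
    ... | yes _ | no nl | _ = no (λ a → nl (proj₁ (proj₂ a)))
    ... | yes _ | yes _ | no ns = no (λ { (_ , _ , s , s≤q , e) → ns (s , s≤s s≤q , e) })
    ... | yes pp | yes le | yes (s , s<q , e) = yes (pp , le , s , NP.≤-pred s<q , e)

    dvd? : ∀ p z → Dec ((+ p) DS.∣ z)
    dvd? p z with p ND.∣? Z.∣ z ∣
    ... | yes d = yes (DS.∣ᵤ⇒∣ d)
    ... | no nd = no (λ d → nd (DS.∣⇒∣ᵤ d))

    -- only positions below the length and primes below the key need checking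
    InA? : ∀ xs → Dec (InA xs)
    InA? xs with NP.allUpTo? (λ i → NP.allUpTo? (λ p → prime? (suc i) →-dec (Act? p (suc i) →-dec dvd? p (at xs i))) (suc (suc i))) (length xs)
    ... | yes h = yes λ i p pr act → f i p pr act
      where
      f : ∀ i p → Prime (suc i) → Act p (suc i) → (+ p) DS.∣ at xs i
      f i p pr act with i N.<? length xs
      ... | yes lt = h lt (s≤s (proj₁ (proj₂ act))) pr act
      ... | no nlt = subst ((+ p) DS.∣_) (sym (at-len xs i (NP.≮⇒≥ nlt))) (DS.divides 0ℤ refl)
    ... | no nh = no λ ina → nh (λ {i} _ {p} _ pr act → ina i p pr act)

    dv0 : ∀ p → (+ p) DS.∣ 0ℤ
    dv0 p = DS.divides 0ℤ refl

    -- constants lie in A: their only coefficient sits at the non-prime key 1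
    InA-pconst : ∀ z → InA (pconst z)
    InA-pconst z zero p pr act = ⊥-elim (¬prime[1] pr)
    InA-pconst z (suc i) p pr act = subst ((+ p) DS.∣_) (sym (at-norm (z ∷ []) (suc i))) (dv0 p)

    InA-padd : ∀ x y → InA x → InA y → InA (padd x y)
    InA-padd x y ix iy i p pr act = subst ((+ p) DS.∣_) (sym (at-padd x y i)) (DS.∣m∣n⇒∣m+n (ix i p pr act) (iy i p pr act))

    InA-pneg : ∀ x → InA x → InA (pneg x)
    InA-pneg x ix i p pr act = subst ((+ p) DS.∣_) (sym (at-pneg x i)) (DS.∣m⇒∣-m (ix i p pr act))

    ⊛-prime : ∀ a b i → Prime (suc i) → a ⊛ b ≡ i → (a ≡ 0 × b ≡ i) ⊎ (a ≡ i × b ≡ 0)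
    ⊛-prime a b i pr e with prime⇒irreducible pr (ND.divides (suc b) (trans (sym (cong suc e)) (trans (⊛-suc a b) (NP.*-comm (suc a) (suc b)))))
    ... | inj₁ refl = inj₁ (refl , trans (sym (NP.+-identityʳ b)) e)
    ... | inj₂ sa≡q = inj₂ (NP.suc-injective sa≡q , NP.suc-injective (NP.*-cancelˡ-≡ (suc b) 1 (suc a) sa*sb≡sa*1))
      where
      open ≡-Reasoning
      sa*sb≡sa*1 : suc a N.* suc b ≡ suc a N.* 1
      sa*sb≡sa*1 = begin
        suc a N.* suc b   ≡⟨ sym (⊛-suc a b) ⟩
        suc (a ⊛ b)       ≡⟨ cong suc e ⟩
        suc i             ≡⟨ sym sa≡q ⟩
        suc a             ≡⟨ sym (NP.*-identityʳ (suc a)) ⟩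
        suc a N.* 1 ∎

    -- closure under multiplication: the coefficient at a prime key q of x·y is
    -- x_1·y_q + x_q·y_1 plus terms that vanish
    InA-pmul : ∀ x y → InA x → InA y → InA (pmul x y)
    InA-pmul x y ix iy i p pr act = subst ((+ p) DS.∣_) (sym (at-pmul x y i)) (PΨ _ x outer)
      where
      open Ideal (PrimeI p (proj₁ act))
      outer : ∀ a → (+ p) DS.∣ (at x a Z.* Ψ (λ b → δ i (a ⊛ b)) y)
      outer a with a N.≟ i
      ... | yes refl = P*ʳ _ (ix a p pr act)
      ... | no a≢i = P*ˡ (at x a) (PΨ _ y inner)
        where
        inner : ∀ b → (+ p) DS.∣ (at y b Z.* δ i (a ⊛ b))
        inner b with (a ⊛ b) N.≟ i
        ... | no ne = subst ((+ p) DS.∣_) (sym (trans (cong (at y b Z.*_) (δ-≢ i (a ⊛ b) (λ e → ne (sym e)))) (ZP.*-zeroʳ (at y b)))) (dv0 p)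
        ... | yes e with ⊛-prime a b i pr e
        ...   | inj₂ (ai , _) = ⊥-elim (a≢i ai)
        ...   | inj₁ (_ , refl) = P*ʳ _ (iy b p pr act)

  module Primality where

    open Subring

    DividesInA : ℕ → Poly → Set
    DividesInA r a = Σ Poly λ h → Normal h × InA h × pmul (pconst (+ r)) h ≡ a

    splitP : ∀ p → Prime p → ∀ x y → (+ p) DS.∣ (x Z.* y) → (+ p) DS.∣ x ⊎ (+ p) DS.∣ y
    splitP p pr x y d with dvd? p x | dvd? p y
    ... | yes a | _ = inj₁ a
    ... | no _ | yes b = inj₂ b
    ... | no na | no nb = ⊥-elim (PIdeal.Pprime (PrimeI p pr) na nb d)

    -- if r is active nowhere, then a/r stays in A: an active p dividing r·(a/r)_i
    -- cannot divide r
    InA-divBy : ∀ r → Prime r → (∀ q → ¬ Act r q) → ∀ a → InA a → (d : ∀ j → (+ r) DS.∣ at a j) → InA (divBy r a d)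
    InA-divBy r pr nact a ia d i p pp act with splitP p (proj₁ act) (at (divBy r a d) i) (+ r) (subst ((+ p) DS.∣_) (sym (at-divBy r a d i)) (ia i p pp act))
    ... | inj₁ p∣quotient = p∣quotient
    ... | inj₂ p∣r with prime⇒irreducible pr (DS.∣⇒∣ᵤ p∣r)
    ...   | inj₁ refl = ⊥-elim (¬prime[1] (proj₁ act))
    ...   | inj₂ refl = ⊥-elim (nact (suc i) act)

    divideInA : ∀ r → Prime r → (∀ q → ¬ Act r q) → ∀ a → Normal a → InA a → (∀ j → (+ r) DS.∣ at a j) → DividesInA r a
    divideInA r pr nact a na ia d = divBy r a d , n-divBy r a d , InA-divBy r pr nact a ia d , divBy-spec r a d na

    primeP : ∀ r → Prime r → (∀ q → ¬ Act r q) → ∀ a b c → Normal a → Normal b → InA a → InA b →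
             pmul (pconst (+ r)) c ≡ pmul a b → DividesInA r a ⊎ DividesInA r b
    primeP r pr nact a b c na nb ia ib e =
      map⊎ (divideInA r pr nact a na ia) (divideInA r pr nact b nb ib) (gauss r pr a b r∣ab)
      where
      r∣ab : ∀ K → (+ r) DS.∣ at (pmul a b) K
      r∣ab K = DS.divides (at c K) (trans (cong (λ l → at l K) (sym e)) (trans (at-scale (+ r) c K) (ZP.*-comm (+ r) (at c K))))

    notPrimeSq : ∀ q → Prime q → ¬ Prime (q N.* q)
    notPrimeSq q pq pqq with prime⇒irreducible pqq (ND.m∣m*n {q} q)
    ... | inj₁ refl = ¬prime[1] pq
    ... | inj₂ e = ¬prime[1] (subst Prime (sym (NP.*-cancelˡ-≡ 1 q q {{prime⇒nonZero pq}} (trans (NP.*-identityʳ q) e))) pq)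

    -- If s witnesses primesBelow p ∈ S, take a prime q > p + s, so p is active
    -- at q, and let N be the product of the primes ≤ q other than p.  Then
    -- u = p·N·X_q lies in A and u² = p·(p·N²·X_{q²}) with p·N²·X_{q²} ∈ A
    -- (q² is not prime), but u / p = N·X_q is not in A because p ∤ N.
    module NonPrimality (p : ℕ) (pp : Prime p) (s : ℕ) (rs : R s (primesBelow p) ≡ true) where

      BP = bigPrime (p N.+ s)
      q = proj₁ BP
      pq : Prime q
      pq = proj₁ (proj₂ BP)
      q>p+s : p N.+ s < q
      q>p+s = proj₂ (proj₂ BP)

      iq : ℕ
      iq = N.pred q
      q≡ : suc iq ≡ q
      q≡ = NP.suc-pred q {{prime⇒nonZero pq}}

      act : Act p (suc iq)
      act = pp , subst (p ≤_) (sym q≡) (NP.≤-trans (NP.m≤m+n p s) (NP.<⇒≤ q>p+s)) ,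
            s , subst (s ≤_) (sym q≡) (NP.≤-trans (NP.m≤n+m s p) (NP.<⇒≤ q>p+s)) , rs

      others? : ∀ x → Dec (Prime x × ¬ x ≡ p)
      others? x = prime? x ×-dec ¬? (x N.≟ p)
      L : List ℕ
      L = filter others? (upTo (suc q))
      Nn : ℕ
      Nn = product L
      allP : All Prime L
      allP = All.tabulate (λ x∈ → proj₁ (proj₂ (∈-filter⁻ others? {xs = upTo (suc q)} x∈)))
      instance
        nzN : N.NonZero Nn
        nzN = product≢0 (All.map prime⇒nonZero allP)
        nzp : N.NonZero p
        nzp = prime⇒nonZero pp
      p∤N : ¬ p ND.∣ Nn
      p∤N d with ∈-filter⁻ others? {xs = upTo (suc q)} (factorisationHasAllPrimeFactors pp d allP)
      ... | _ , _ , p≢p = p≢p refl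

      u c : Poly
      u = pad iq (+ (p N.* Nn))
      c = pad (iq ⊛ iq) (+ (p N.* (Nn N.* Nn)))

      nu : Normal u
      nu = normal-pad iq (+ (p N.* Nn)) λ e → N.≢-nonZero⁻¹ (p N.* Nn) {{NP.m*n≢0 p Nn}} (ZP.+-injective e)

      nc : Normal c
      nc = normal-pad (iq ⊛ iq) (+ (p N.* (Nn N.* Nn))) λ e →
        N.≢-nonZero⁻¹ (p N.* (Nn N.* Nn)) {{NP.m*n≢0 p (Nn N.* Nn) {{nzp}} {{NP.m*n≢0 Nn Nn}}}} (ZP.+-injective e)

      -- every prime p' active at q is ≤ q, hence p' = p or p' ∣ N
      iu : InA u
      iu i p' pr' act' with i N.≟ iq
      ... | no ne = subst ((+ p') DS.∣_) (sym (at-pad-other iq _ i ne)) (dv0 p')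
      ... | yes refl = subst ((+ p') DS.∣_) (sym (at-pad-same iq _)) (DS.∣ᵤ⇒∣ p'∣pN)
        where
        p'≤q : p' ≤ q
        p'≤q = subst (p' ≤_) q≡ (proj₁ (proj₂ act'))
        p'∣pN : p' ND.∣ p N.* Nn
        p'∣pN with p' N.≟ p
        ... | yes refl = ND.m∣m*n Nn
        ... | no ne = ND.∣n⇒∣m*n p (∈⇒∣product (∈-filter⁺ others? (∈-upTo⁺ (s≤s p'≤q)) (proj₁ act' , ne)))

      -- c lives at the key q², which is not prime
      ic : InA c
      ic i p' pr' act' with i N.≟ (iq ⊛ iq)
      ... | no ne = subst ((+ p') DS.∣_) (sym (at-pad-other (iq ⊛ iq) _ i ne)) (dv0 p')
      ... | yes refl = ⊥-elim (notPrimeSq q pq (subst Prime (trans (⊛-suc iq iq) (cong₂ N._*_ q≡ q≡)) pr'))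

      p·c≡u² : pmul (pconst (+ p)) c ≡ pmul u u
      p·c≡u² = extΨ (pmul (pconst (+ p)) c) (pmul u u) (n-pmul (pconst (+ p)) c) (n-pmul u u) λ G →
        trans (Ψ-scale G (+ p) c) (trans (cong (+ p Z.*_) (Ψ-pad G (iq ⊛ iq) _))
        (trans (lem p Nn (G (iq ⊛ iq)))
        (sym (trans (Ψ-pmul G u u) (trans (Ψ-pad _ iq _) (cong (+ (p N.* Nn) Z.*_) (Ψ-pad _ iq _)))))))
        where
        lem : ∀ p n g → + p Z.* (+ (p N.* (n N.* n)) Z.* g) ≡ + (p N.* n) Z.* (+ (p N.* n) Z.* g)
        lem p n g = trans (cong (λ z → + p Z.* (z Z.* g)) (trans (ZP.pos-* p (n N.* n)) (cong (+ p Z.*_) (ZP.pos-* n n))))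
                    (trans (l2 (+ p) (+ n) g) (sym (cong₂ (λ a b → a Z.* (b Z.* g)) (ZP.pos-* p n) (ZP.pos-* p n))))
          where l2 : ∀ a b g → a Z.* (a Z.* (b Z.* b) Z.* g) ≡ a Z.* b Z.* (a Z.* b Z.* g)
                l2 = solve-∀

      -- if p·w = u then w_q = N, which p must divide when w ∈ A
      p∤u : ∀ w → InA w → ¬ pmul (pconst (+ p)) w ≡ u
      p∤u w iw e = p∤N (DS.∣⇒∣ᵤ (subst ((+ p) DS.∣_) wq≡N (iw iq p (subst Prime (sym q≡) pq) act)))
        where
        p·wq≡p·N : + p Z.* at w iq ≡ + p Z.* + Nn
        p·wq≡p·N = trans (sym (at-scale (+ p) w iq)) (trans (cong (λ l → at l iq) e) (trans (at-pad-same iq _) (ZP.pos-* p Nn)))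
        wq≡N : at w iq ≡ + Nn
        wq≡N = ZP.*-cancelˡ-≡ (+ p) (at w iq) (+ Nn) p·wq≡p·N

  -- The finite list of candidate divisors of a: all normal elements of A within
  -- the length and coefficient bounds of DivisorBound.
  module DivisorEnumeration where

    open Z using (∣_∣)
    open Subring

    _≟P_ : (x y : Poly) → Dec (x ≡ y)
    _≟P_ = LP.≡-dec Z._≟_

    Valid : Poly → Set
    Valid xs = Normal xs × InA xs

    Valid? : ∀ xs → Dec (Valid xs)
    Valid? xs = (norm xs ≟P xs) ×-dec InA? xs

    range : ℕ → List ℤ
    range B = map +_ (upTo (suc B)) ++ map -[1+_] (upTo B)

    ∈-range : ∀ B z → ∣ z ∣ ≤ B → z ∈ range B
    ∈-range B (+ k) le = ∈-++⁺ˡ (∈-map⁺ +_ (∈-upTo⁺ (s≤s le)))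
    ∈-range B -[1+ k ] le = ∈-++⁺ʳ (map +_ (upTo (suc B))) (∈-map⁺ -[1+_] (∈-upTo⁺ le))

    consAll : List ℤ → List Poly → List Poly
    consAll [] ps = []
    consAll (z ∷ zs) ps = map (z ∷_) ps ++ consAll zs ps

    ∈-consAll : ∀ {z p} zs ps → z ∈ zs → p ∈ ps → (z ∷ p) ∈ consAll zs ps
    ∈-consAll (z ∷ zs) ps (here refl) p∈ = ∈-++⁺ˡ (∈-map⁺ (z ∷_) p∈)
    ∈-consAll (z' ∷ zs) ps (there z∈) p∈ = ∈-++⁺ʳ (map (z' ∷_) ps) (∈-consAll zs ps z∈ p∈)

    allPolys : ℕ → ℕ → List Poly
    allPolys zero B = [] ∷ []
    allPolys (suc M) B = [] ∷ consAll (range B) (allPolys M B)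

    ∈-allPolys : ∀ M B xs → length xs ≤ M → (∀ i → ∣ at xs i ∣ ≤ B) → xs ∈ allPolys M B
    ∈-allPolys zero B [] le h = here refl
    ∈-allPolys (suc M) B [] le h = here refl
    ∈-allPolys (suc M) B (x ∷ xs) (s≤s le) h =
      there (∈-consAll (range B) (allPolys M B) (∈-range B x (h 0)) (∈-allPolys M B xs le (λ i → h (suc i))))

    cands : Poly → List Poly
    cands a = allPolys (length a) (Bd a)

    IsDiv : Poly → Poly → Set
    IsDiv a b = Valid b × Any (λ c → Valid c × pmul b c ≡ a) (cands a)

    IsDiv? : ∀ a b → Dec (IsDiv a b)
    IsDiv? a b = Valid? b ×-dec any? (λ c → Valid? c ×-dec (pmul b c ≟P a)) (cands a)

    divs : Poly → List Poly
    divs a = filter (IsDiv? a) (cands a)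

    divs-sound : ∀ a b → b ∈ divs a → Valid b × Σ Poly (λ c → Valid c × pmul b c ≡ a)
    divs-sound a b b∈ with ∈-filter⁻ (IsDiv? a) {xs = cands a} b∈
    ... | _ , vb , an with find an
    ...   | c , _ , vc , e = vb , c , vc , e

    -- every divisor of a ≠ 0 inside A is listed (A is a domain, so its cofactor is bounded too)
    divs-complete : ∀ a → Normal a → ¬ a ≡ [] → ∀ b c → Valid b → Valid c → pmul b c ≡ a → b ∈ divs a
    divs-complete a na ne b c vb vc e = ∈-filter⁺ (IsDiv? a) (inC b c vb vc e) (vb , lose (inC c b vc vb (trans (*-commP c b) e)) (vc , e))
      where
      inC : ∀ b c → Valid b → Valid c → pmul b c ≡ a → b ∈ cands a
      inC b c vb vc e = let bd = divBound a b c na (proj₁ vb) (proj₁ vc) ne e in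
        ∈-allPolys (length a) (Bd a) b (proj₁ bd) (proj₂ bd)


  -- The domain A itself: elements are the codes of normal lists in A.
  module Realisation where

    open Subring
    open DivisorEnumeration

    -- n ∈ A iff n codes a valid list and is the canonical code of it
    dom : ℕ → Bool
    dom n = isYes (Valid? (dec n) ×-dec (enc (dec n) N.≟ n))

    El : Set
    El = Elt dom

    ⟦_⟧ : El → Poly
    ⟦ x ⟧ = dec (proj₁ x)

    valid⟦⟧ : ∀ x → Valid ⟦ x ⟧
    valid⟦⟧ (n , t) = proj₁ (toWitness {a? = Valid? (dec n) ×-dec (enc (dec n) N.≟ n)} t)

    codeEq : ∀ x → enc ⟦ x ⟧ ≡ proj₁ x
    codeEq (n , t) = proj₂ (toWitness {a? = Valid? (dec n) ×-dec (enc (dec n) N.≟ n)} t)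

    mk : (xs : Poly) → Valid xs → El
    mk xs v = enc xs , subst (λ ys → T (isYes (Valid? ys ×-dec (enc ys N.≟ enc xs)))) (sym (dec-enc xs))
                         (fromWitness {a? = Valid? xs ×-dec (enc xs N.≟ enc xs)} (v , refl))

    ⟦mk⟧ : ∀ xs v → ⟦ mk xs v ⟧ ≡ xs
    ⟦mk⟧ xs v = dec-enc xs

    -- elements are determined by their representatives (membership proofs are irrelevant)
    El-ext : ∀ x y → ⟦ x ⟧ ≡ ⟦ y ⟧ → x ≡ y
    El-ext (n , t) (m , u) e with trans (sym (codeEq (n , t))) (trans (cong enc e) (codeEq (m , u)))
    ... | refl = cong (n ,_) (T-irrelevant t u)

    nrm : ∀ x → Normal ⟦ x ⟧
    nrm x = proj₁ (valid⟦⟧ x)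

    ina : ∀ x → InA ⟦ x ⟧
    ina x = proj₂ (valid⟦⟧ x)

    infixl 7 _*E_
    infixl 6 _+E_
    _+E_ : El → El → El
    x +E y = mk (padd ⟦ x ⟧ ⟦ y ⟧) (n-padd ⟦ x ⟧ ⟦ y ⟧ , InA-padd ⟦ x ⟧ ⟦ y ⟧ (ina x) (ina y))

    _*E_ : El → El → El
    x *E y = mk (pmul ⟦ x ⟧ ⟦ y ⟧) (n-pmul ⟦ x ⟧ ⟦ y ⟧ , InA-pmul ⟦ x ⟧ ⟦ y ⟧ (ina x) (ina y))

    -E_ : El → El
    -E x = mk (pneg ⟦ x ⟧) (n-pneg ⟦ x ⟧ , InA-pneg ⟦ x ⟧ (ina x))

    0E : El
    0E = mk [] (refl , InA-pconst 0ℤ)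

    ι : ℤ → El
    ι z = mk (pconst z) (n-pconst z , InA-pconst z)

    1E : El
    1E = ι 1ℤ

    ⟦+⟧ : ∀ x y → ⟦ x +E y ⟧ ≡ padd ⟦ x ⟧ ⟦ y ⟧
    ⟦+⟧ x y = dec-enc (padd ⟦ x ⟧ ⟦ y ⟧)
    ⟦*⟧ : ∀ x y → ⟦ x *E y ⟧ ≡ pmul ⟦ x ⟧ ⟦ y ⟧
    ⟦*⟧ x y = dec-enc (pmul ⟦ x ⟧ ⟦ y ⟧)
    ⟦-⟧ : ∀ x → ⟦ -E x ⟧ ≡ pneg ⟦ x ⟧
    ⟦-⟧ x = dec-enc (pneg ⟦ x ⟧)
    ⟦0⟧ : ⟦ 0E ⟧ ≡ []
    ⟦0⟧ = dec-enc []
    ⟦ι⟧ : ∀ z → ⟦ ι z ⟧ ≡ pconst z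
    ⟦ι⟧ z = dec-enc (pconst z)

    +-assocE : ∀ x y z → (x +E y) +E z ≡ x +E (y +E z)
    +-assocE x y z = El-ext ((x +E y) +E z) (x +E (y +E z)) (trans (⟦+⟧ (x +E y) z) (trans (cong (λ w → padd w ⟦ z ⟧) (⟦+⟧ x y))
      (trans (+-assocP ⟦ x ⟧ ⟦ y ⟧ ⟦ z ⟧) (sym (trans (⟦+⟧ x (y +E z)) (cong (padd ⟦ x ⟧) (⟦+⟧ y z)))))))

    +-commE : ∀ x y → x +E y ≡ y +E x
    +-commE x y = El-ext (x +E y) (y +E x) (trans (⟦+⟧ x y) (trans (+-commP ⟦ x ⟧ ⟦ y ⟧) (sym (⟦+⟧ y x))))

    +-idˡE : ∀ x → 0E +E x ≡ x
    +-idˡE x = El-ext (0E +E x) x (trans (⟦+⟧ 0E x) (trans (cong (λ w → padd w ⟦ x ⟧) ⟦0⟧) (+-idˡP ⟦ x ⟧ (nrm x))))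

    +-idʳE : ∀ x → x +E 0E ≡ x
    +-idʳE x = trans (+-commE x 0E) (+-idˡE x)

    +-invˡE : ∀ x → (-E x) +E x ≡ 0E
    +-invˡE x = El-ext ((-E x) +E x) 0E (trans (⟦+⟧ (-E x) x) (trans (cong (λ w → padd w ⟦ x ⟧) (⟦-⟧ x)) (trans (+-invˡP ⟦ x ⟧) (sym ⟦0⟧))))

    +-invʳE : ∀ x → x +E (-E x) ≡ 0E
    +-invʳE x = trans (+-commE x (-E x)) (+-invˡE x)

    *-assocE : ∀ x y z → (x *E y) *E z ≡ x *E (y *E z)
    *-assocE x y z = El-ext ((x *E y) *E z) (x *E (y *E z)) (trans (⟦*⟧ (x *E y) z) (trans (cong (λ w → pmul w ⟦ z ⟧) (⟦*⟧ x y))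
      (trans (*-assocP ⟦ x ⟧ ⟦ y ⟧ ⟦ z ⟧) (sym (trans (⟦*⟧ x (y *E z)) (cong (pmul ⟦ x ⟧) (⟦*⟧ y z)))))))

    *-commE : ∀ x y → x *E y ≡ y *E x
    *-commE x y = El-ext (x *E y) (y *E x) (trans (⟦*⟧ x y) (trans (*-commP ⟦ x ⟧ ⟦ y ⟧) (sym (⟦*⟧ y x))))

    *-idˡE : ∀ x → 1E *E x ≡ x
    *-idˡE x = El-ext (1E *E x) x (trans (⟦*⟧ 1E x) (trans (cong (λ w → pmul w ⟦ x ⟧) (⟦ι⟧ 1ℤ)) (*-idˡP ⟦ x ⟧ (nrm x))))

    *-idʳE : ∀ x → x *E 1E ≡ x
    *-idʳE x = trans (*-commE x 1E) (*-idˡE x)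

    distribˡE : ∀ x y z → x *E (y +E z) ≡ (x *E y) +E (x *E z)
    distribˡE x y z = El-ext (x *E (y +E z)) ((x *E y) +E (x *E z)) (trans (⟦*⟧ x (y +E z)) (trans (cong (pmul ⟦ x ⟧) (⟦+⟧ y z))
      (trans (distribˡP ⟦ x ⟧ ⟦ y ⟧ ⟦ z ⟧) (sym (trans (⟦+⟧ (x *E y) (x *E z)) (cong₂ padd (⟦*⟧ x y) (⟦*⟧ x z)))))))

    distribʳE : ∀ x y z → (y +E z) *E x ≡ (y *E x) +E (z *E x)
    distribʳE x y z = El-ext ((y +E z) *E x) ((y *E x) +E (z *E x)) (trans (⟦*⟧ (y +E z) x) (trans (cong (λ w → pmul w ⟦ x ⟧) (⟦+⟧ y z))
      (trans (*-commP (padd ⟦ y ⟧ ⟦ z ⟧) ⟦ x ⟧) (trans (distribˡP ⟦ x ⟧ ⟦ y ⟧ ⟦ z ⟧)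
      (trans (cong₂ padd (*-commP ⟦ x ⟧ ⟦ y ⟧) (*-commP ⟦ x ⟧ ⟦ z ⟧))
      (sym (trans (⟦+⟧ (y *E x) (z *E x)) (cong₂ padd (⟦*⟧ y x) (⟦*⟧ z x)))))))))

    isCR : IsCommutativeRing _≡_ _+E_ _*E_ -E_ 0E 1E
    isCR = record
      { isRing = record
        { +-isAbelianGroup = record
          { isGroup = record
            { isMonoid = record
              { isSemigroup = record
                { isMagma = record { isEquivalence = isEquivalence ; ∙-cong = cong₂ _+E_ }
                ; assoc = +-assocE }
              ; identity = +-idˡE , +-idʳE }
            ; inverse = +-invˡE , +-invʳE
            ; ⁻¹-cong = cong -E_ }
          ; comm = +-commE }
        ; *-cong = cong₂ _*E_
        ; *-assoc = *-assocE
        ; *-identity = *-idˡE , *-idʳE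
        ; distrib = distribˡE , distribʳE }
      ; *-comm = *-commE }

    ⟦1⟧ : ⟦ 1E ⟧ ≡ 1ℤ ∷ []
    ⟦1⟧ = ⟦ι⟧ 1ℤ

    1≢0E : ¬ 1E ≡ 0E
    1≢0E e with trans (sym ⟦1⟧) (trans (cong ⟦_⟧ e) ⟦0⟧)
    ... | ()

    is0 : ∀ x → ⟦ x ⟧ ≡ [] → x ≡ 0E
    is0 x e = El-ext x 0E (trans e (sym ⟦0⟧))

    noZD : ∀ a b → a *E b ≡ 0E → a ≡ 0E ⊎ b ≡ 0E
    noZD a b e with ⟦ a ⟧ ≟P [] | ⟦ b ⟧ ≟P []
    ... | yes ea | _ = inj₁ (is0 a ea)
    ... | no _ | yes eb = inj₂ (is0 b eb)
    ... | no na | no nb = ⊥-elim (pmul-nz ⟦ a ⟧ ⟦ b ⟧ (nrm a) (nrm b) na nb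
              (trans (sym (⟦*⟧ a b)) (trans (cong ⟦_⟧ e) ⟦0⟧)))

    toE : Poly → El
    toE xs with Valid? xs
    ... | yes v = mk xs v
    ... | no _ = 0E

    ⟦toE⟧ : ∀ xs → Valid xs → ⟦ toE xs ⟧ ≡ xs
    ⟦toE⟧ xs v with Valid? xs
    ... | yes v' = ⟦mk⟧ xs v'
    ... | no nv = ⊥-elim (nv v)

    DE : El → List El
    DE a = map toE (divs ⟦ a ⟧)

    D-to : ∀ a b → b ∈ DE a → ∃ λ c → b *E c ≡ a
    D-to a b b∈ with ∈-map⁻ toE b∈
    ... | b' , b'∈ , eb with divs-sound ⟦ a ⟧ b' b'∈
    ...   | vb , c , vc , e = mk c vc , El-ext (b *E mk c vc) a
                (trans (⟦*⟧ b (mk c vc)) (trans (cong₂ pmul (trans (cong ⟦_⟧ eb) (⟦toE⟧ b' vb)) (⟦mk⟧ c vc)) e))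

    D-from : ∀ a → ¬ a ≡ 0E → ∀ b → (∃ λ c → b *E c ≡ a) → b ∈ DE a
    D-from a na b (c , e) = subst (λ w → w ∈ DE a) (El-ext (toE ⟦ b ⟧) b (⟦toE⟧ ⟦ b ⟧ (valid⟦⟧ b)))
        (∈-map⁺ toE (divs-complete ⟦ a ⟧ (nrm a) (λ e0 → na (is0 a e0)) ⟦ b ⟧ ⟦ c ⟧ (valid⟦⟧ b) (valid⟦⟧ c)
          (trans (sym (⟦*⟧ b c)) (cong ⟦_⟧ e))))

    D-specE : ∀ a → ¬ a ≡ 0E → ∀ b → (b ∈ DE a) ⇔ (∃ λ c → b *E c ≡ a)
    D-specE a na b = mk⇔ (D-to a b) (D-from a na b)

    𝒜 : SCFFD
    𝒜 = record
      { dom = dom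
      ; _+_ = _+E_
      ; _*_ = _*E_
      ; -_ = -E_
      ; 0# = 0E
      ; 1# = 1E
      ; isCommutativeRing = isCR
      ; 1≢0 = 1≢0E
      ; noZeroDivisors = noZD
      ; D = DE
      ; D-spec = D-specE
      }

    ι-* : ∀ a b → ι (a Z.* b) ≡ ι a *E ι b
    ι-* a b = El-ext (ι (a Z.* b)) (ι a *E ι b) (sym (trans (⟦*⟧ (ι a) (ι b)) (trans (cong₂ pmul (⟦ι⟧ a) (⟦ι⟧ b)) (trans (pconst-mul a b) (sym (⟦ι⟧ (a Z.* b)))))))

    ι-+ : ∀ a b → ι (a Z.+ b) ≡ ι a +E ι b
    ι-+ a b = El-ext (ι (a Z.+ b)) (ι a +E ι b) (sym (trans (⟦+⟧ (ι a) (ι b)) (trans (cong₂ padd (⟦ι⟧ a) (⟦ι⟧ b)) (trans (pconst-add a b) (sym (⟦ι⟧ (a Z.+ b)))))))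

    ι-inj : ∀ a b → ι a ≡ ι b → a ≡ b
    ι-inj a b e = pconst-inj a b (trans (sym (⟦ι⟧ a)) (trans (cong ⟦_⟧ e) (⟦ι⟧ b)))

    ⟦ι*⟧ : ∀ z w → ⟦ ι z *E w ⟧ ≡ pmul (pconst z) ⟦ w ⟧
    ⟦ι*⟧ z w = trans (⟦*⟧ (ι z) w) (cong (λ v → pmul v ⟦ w ⟧) (⟦ι⟧ z))

    len-pconst : ∀ z → length (pconst z) ≤ 1
    len-pconst z with z Z.≟ 0ℤ
    ... | yes _ = z≤n
    ... | no _ = s≤s z≤n

    constFactors : ∀ x y z → ¬ z ≡ 0ℤ → x *E y ≡ ι z →
      Σ ℤ λ α → Σ ℤ λ β → (x ≡ ι α) × (y ≡ ι β) × (α Z.* β ≡ z)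
    constFactors x y z nz e = at ⟦ x ⟧ 0 , at ⟦ y ⟧ 0 , exx , eyy , ab
      where
      e' : pmul ⟦ x ⟧ ⟦ y ⟧ ≡ pconst z
      e' = trans (sym (⟦*⟧ x y)) (trans (cong ⟦_⟧ e) (⟦ι⟧ z))
      pz : ¬ pconst z ≡ []
      pz e0 = nz (trans (sym (at-pconst0 z)) (cong (λ l → at l 0) e0))
      mc = mul-const ⟦ x ⟧ ⟦ y ⟧ (nrm x) (nrm y) (subst (λ l → length l ≤ 1) (sym e') (len-pconst z))
             (λ e0 → pz (trans (sym e') e0))
      exx : x ≡ ι (at ⟦ x ⟧ 0)
      exx = El-ext x (ι (at ⟦ x ⟧ 0)) (trans (proj₁ mc) (sym (⟦ι⟧ _)))
      eyy : y ≡ ι (at ⟦ y ⟧ 0)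
      eyy = El-ext y (ι (at ⟦ y ⟧ 0)) (trans (proj₂ mc) (sym (⟦ι⟧ _)))
      ab : at ⟦ x ⟧ 0 Z.* at ⟦ y ⟧ 0 ≡ z
      ab = pconst-inj _ _ (trans (sym (pconst-mul (at ⟦ x ⟧ 0) (at ⟦ y ⟧ 0)))
             (trans (cong₂ pmul (sym (proj₁ mc)) (sym (proj₂ mc))) e'))


  module Properties where

    open Subring
    open Primality
    open Realisation
    open DomainNotions 𝒜

    IsSign : El → Set
    IsSign u = u ≡ ι 1ℤ ⊎ u ≡ ι (Z.- 1ℤ)

    toUnit : ∀ x α → x ≡ ι α → α ≡ 1ℤ ⊎ α ≡ Z.- 1ℤ → IsUnit x
    toUnit x α refl (inj₁ refl) = ι 1ℤ , sym (ι-* 1ℤ 1ℤ)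
    toUnit x α refl (inj₂ refl) = ι (Z.- 1ℤ) , sym (ι-* (Z.- 1ℤ) (Z.- 1ℤ))

    -- a unit divides the constant 1, so it is a constant unit of ℤ
    unitsTo : ∀ u → IsUnit u → IsSign u
    unitsTo u (v , e) = sign (constFactors u v 1ℤ (λ ()) e)
      where
      sign : (Σ ℤ λ α → Σ ℤ λ β → (u ≡ ι α) × (v ≡ ι β) × (α Z.* β ≡ 1ℤ)) → IsSign u
      sign (α , β , u≡α , _ , αβ≡1) with unitℤ α β αβ≡1
      ... | inj₁ refl = inj₁ u≡α
      ... | inj₂ refl = inj₂ u≡α

    unitsFrom : ∀ u → IsSign u → IsUnit u
    unitsFrom u (inj₁ u≡1) = toUnit u 1ℤ u≡1 (inj₁ refl)
    unitsFrom u (inj₂ u≡-1) = toUnit u (Z.- 1ℤ) u≡-1 (inj₂ refl)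

    units : ∀ u → IsUnit u ⇔ (u ≡ ι (Z.+ 1) ⊎ u ≡ ι (Z.- (Z.+ 1)))
    units u = mk⇔ (unitsTo u) (unitsFrom u)

    module _ (p : ℕ) (pr : Prime p) where

      p≢0 : ¬ Z.+ p ≡ 0ℤ
      p≢0 e = N.≢-nonZero⁻¹ p {{prime⇒nonZero pr}} (ZP.+-injective e)

      ιp-nz : ¬ ι (Z.+ p) ≡ 0E
      ιp-nz e = p≢0 (trans (sym (at-pconst0 (Z.+ p))) (cong (λ l → at l 0) (trans (sym (⟦ι⟧ (Z.+ p))) (trans (cong ⟦_⟧ e) ⟦0⟧))))

      ιp-nu : ¬ IsUnit (ι (Z.+ p))
      ιp-nu un = notSign (unitsTo (ι (Z.+ p)) un)
        where
        notSign : ¬ IsSign (ι (Z.+ p))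
        notSign (inj₁ e) = ¬prime[1] (subst Prime (ZP.+-injective (ι-inj (Z.+ p) 1ℤ e)) pr)
        notSign (inj₂ e) with ι-inj (Z.+ p) (Z.- 1ℤ) e
        ... | ()

      -- a factorisation of p in A is a factorisation of p in ℤ
      irreducible : IsIrreducible (ι (Z.+ p))
      irreducible = ιp-nz , ιp-nu , factors
        where
        fromℤ : ∀ a b → (Σ ℤ λ α → Σ ℤ λ β → (a ≡ ι α) × (b ≡ ι β) × (α Z.* β ≡ Z.+ p)) → IsUnit a ⊎ IsUnit b
        fromℤ a b (α , β , a≡α , b≡β , αβ≡p) = map⊎ (toUnit a α a≡α) (toUnit b β b≡β) (primeℤ p pr α β αβ≡p)
        factors : ∀ a b → a *E b ≡ ι (Z.+ p) → IsUnit a ⊎ IsUnit b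
        factors a b e = fromℤ a b (constFactors a b (Z.+ p) p≢0 e)

      module _ (i : ℕ) (pb : primesBelow p ≡ i) where

        -- if i ∉ S then p is active nowhere, and Gauss' lemma applies
        primeFrom : ¬ Σ₁Set R i → IsPrime (ι (Z.+ p))
        primeFrom i∉S = ιp-nz , ιp-nu , split
          where
          nact : ∀ q → ¬ Act p q
          nact q (_ , _ , s , _ , rs) = i∉S (s , subst (λ j → R s j ≡ true) pb rs)
          lift : ∀ a → DividesInA p ⟦ a ⟧ → ι (Z.+ p) ∣ a
          lift a (h , nh , ih , eh) = mk h (nh , ih) ,
            El-ext (ι (Z.+ p) *E mk h (nh , ih)) a (trans (⟦ι*⟧ (Z.+ p) (mk h (nh , ih))) (trans (cong (pmul (pconst (Z.+ p))) (⟦mk⟧ h (nh , ih))) eh))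
          split : ∀ a b → ι (Z.+ p) ∣ (a *E b) → ι (Z.+ p) ∣ a ⊎ ι (Z.+ p) ∣ b
          split a b (c , e) = map⊎ (lift a) (lift b)
            (primeP p pr nact ⟦ a ⟧ ⟦ b ⟧ ⟦ c ⟧ (nrm a) (nrm b) (ina a) (ina b)
              (trans (sym (⟦ι*⟧ (Z.+ p) c)) (trans (cong ⟦_⟧ e) (⟦*⟧ a b))))

        -- if i ∈ S, the element u of NonPrimality has p ∣ u·u but p ∤ u
        primeTo : IsPrime (ι (Z.+ p)) → ¬ Σ₁Set R i
        primeTo (_ , _ , isPrime) (s , rs) = [ p∤U , p∤U ]′ (isPrime U U p∣U²)
          where
          open NonPrimality p pr s (subst (λ j → R s j ≡ true) (sym pb) rs) using (u; c; nu; nc; iu; ic; p·c≡u²; p∤u)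
          U = mk u (nu , iu)
          C = mk c (nc , ic)
          p∣U² : ι (Z.+ p) ∣ (U *E U)
          p∣U² = C , El-ext (ι (Z.+ p) *E C) (U *E U) (begin
              ⟦ ι (Z.+ p) *E C ⟧            ≡⟨ ⟦ι*⟧ (Z.+ p) C ⟩
              pmul (pconst (Z.+ p)) ⟦ C ⟧   ≡⟨ cong (pmul (pconst (Z.+ p))) (⟦mk⟧ c (nc , ic)) ⟩
              pmul (pconst (Z.+ p)) c       ≡⟨ p·c≡u² ⟩
              pmul u u                      ≡⟨ sym (cong₂ pmul (⟦mk⟧ u (nu , iu)) (⟦mk⟧ u (nu , iu))) ⟩
              pmul ⟦ U ⟧ ⟦ U ⟧              ≡⟨ sym (⟦*⟧ U U) ⟩
              ⟦ U *E U ⟧ ∎)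
            where open ≡-Reasoning
          p∤U : ¬ ι (Z.+ p) ∣ U
          p∤U (w , ew) = p∤u ⟦ w ⟧ (ina w) (trans (sym (⟦ι*⟧ (Z.+ p) w)) (trans (cong ⟦_⟧ ew) (⟦mk⟧ u (nu , iu))))


mainTheorem11 : (R : ℕ → ℕ → Bool) → Σ SCFFD (Theorem11Properties R)
mainTheorem11 R =
  𝒜 , ι , ((ι-+ , ι-* , refl) , (λ {x} {y} → ι-inj x y)) , units ,
  λ i p pr pb → irreducible p pr , mk⇔ (primeTo p pr i pb) (primeFrom p pr i pb)
  where
  open Construction R
  open Realisation
  open Properties
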